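{- For all $n$ we have (1) $|Z^{\mathsf{BC}}_{[\bar n,n]}|=|Z^{\mathsf A}_{[1,n+1]}|$, and (2) $|D^{\mathsf{BC}}_{[\bar n,n]}|=|D^{\mathsf A}_{[1,n+1]}|=\frac{1}{n+2}\binom{2n+2}{n+1}$.
   Context: $[\bar n,n]=\{ -n,\dots,-1,1,\dots,n\}$, $\bar a=-a$, $[h,l]=\{h,\dots,l\}\setminus\{0\}$. Type-A planar network on $[h,l]$: directed planar acyclic multigraph in a disc with boundary vertices labelled clockwise source $h,\dots,$ source $l$, sink $l,\dots,$ sink $h$; edges may carry positive integer multiplicities; sources have indegree 0, outdegree 1, sinks indegree 1, outdegree 0. Networks are identified when isomorphic as directed multigraphs via an isomorphism preserving source/sink labels and multiplicities. For $[a,b]\subseteq[h,l]$, $F_{[a,b]}$ has an edge source $i\to$ sink $i$ for $i\notin[a,b]$ and one interior vertex $z$ with edges source $i\to z\to$ sink $i$ for $i\in[a,b]$ (no interior vertex if $a=b$; this trivial network is $F_\emptyset$). $E\bullet F$: merge, for each $i$, the edge into sink $i$ of $E$ with the edge out of source $i$ of $F$, then replace each set of $m>1$ parallel edges by one edge of multiplicity $m$. Intervals $[c_1,d_1],\dots,[c_t,d_t]$ are distinct and pairwise non-nesting in both of the following; they satisfy the zig-zag conditions if moreover for all $i<j<k$ with $[c_i,d_i]\cap[c_j,d_j]\ne\emptyset\ne[c_j,d_j]\cap[c_k,d_k]$ one has $c_i<c_j<c_k$ or $c_i>c_j>c_k$; they satisfy the descending conditions if moreover for all $i<j$ with $[c_i,d_i]\cap[c_j,d_j]\ne\emptyset$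 one has $c_i>c_j$. $Z^{\mathsf A}_{[h,l]}$ ($D^{\mathsf A}_{[h,l]}$) is the set of networks $F_\emptyset$ and $F_{[c_1,d_1]}\bullet\cdots\bullet F_{[c_t,d_t]}$ with intervals in $[h,l]$ satisfying the zig-zag (descending) conditions. Type-$\mathsf{BC}$ simple stars on $[\bar n,n]$: $F'_{[a,b]}=F_{[a,b]}\bullet F_{[\bar b,\bar a]}$ ($1\le a\le b\le n$) and $F'_{[\bar a,a]}=F_{[\bar a,a]}$ ($1\le a\le n$). $Z^{\mathsf{BC}}_{[\bar n,n]}$ ($D^{\mathsf{BC}}_{[\bar n,n]}$) is the set of networks $F'_{[c_1,d_1]}\bullet\cdots\bullet F'_{[c_t,d_t]}$ (including the trivial one) whose intervals satisfy the zig-zag (descending) conditions. -}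

module Defs where

open import Data.Nat as ℕ using (ℕ; zero; suc)
open import Data.Nat.Combinatorics using (_C_)
open import Data.Integer as ℤ using (ℤ; +_; -_; _≤_; _<_; _>_)
open import Data.Fin using (Fin; zero; suc) renaming (_+_ to _⊕_)
open import Data.Fin as F using ()
open import Data.List using (List; []; _∷_; _++_; map; concatMap; filter; length; lookup)
open import Data.List.Relation.Binary.Permutation.Propositional using (_↭_)
open import Data.List.Relation.Unary.Unique.Propositional using (Unique)
open import Data.List.Relation.Unary.All using (All)
open import Data.List.Membership.Propositional using (_∈_)
open import Data.Product using (Σ; ∃; _×_; _,_; proj₁; proj₂)
open import Data.Sum using (_⊎_)
open import Data.Bool using (Bool; true; false; if_then_else_; _∧_)
open import Relation.Nullary using (¬_; does)
open import Relation.Binary.PropositionalEquality using (_≡_; _≢_)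
open import Function.Bundles using (_↔_; Inverse)

range : ℤ → ℕ → List ℤ
range h zero = []
range h (suc k) = h ∷ range (h ℤ.+ ℤ.+ 1) k

nonzero : ℤ → Bool
nonzero (+ zero) = false
nonzero _ = true

-- the list of elements of [h,l] = {h,..,l} \ {0}  (for h ≤ l)
labels : ℤ → ℤ → List ℤ
labels h l = filter (λ i → nonzero i Data.Bool.≟ true)
                    (range h (suc ℤ.∣ l ℤ.- h ∣))

-- Networks as directed multigraphs.
-- Vertices: boundary sources and sinks labelled by integers, and
-- m interior vertices.  A multigraph with edge multiplicities is
-- represented by its multiset of edges (an edge of multiplicity k
-- appears k times in the list); multisets are compared up to
-- permutation.

data V (m : ℕ) : Set where
  src : ℤ → V m
  snk : ℤ → V m
  int : Fin m → V m

record Network : Set where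
  constructor net
  field
    nInt  : ℕ
    edges : List (V nInt × V nInt)
open Network public

mapV : ∀ {m m'} → (Fin m → Fin m') → V m → V m'
mapV f (src i) = src i
mapV f (snk i) = snk i
mapV f (int x) = int (f x)

mapE : ∀ {m m'} → (Fin m → Fin m') → V m × V m → V m' × V m'
mapE f (u , v) = mapV f u , mapV f v

_≅_ : Network → Network → Set
net m E ≅ net m' E' =
  Σ (Fin m ↔ Fin m') λ σ → map (mapE (Inverse.to σ)) E ↭ E'

trivial : List ℤ → Network
trivial L = net 0 (map (λ i → src i , snk i) L)

_≤ᵇ_ : ℤ → ℤ → Bool
a ≤ᵇ b = does (a ℤ.≤? b)

_<ᵇ_ : ℤ → ℤ → Bool
a <ᵇ b = does (a ℤ.<? b)

_==_ : ℤ → ℤ → Bool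
a == b = does (a ℤ.≟ b)

star : List ℤ → ℤ → ℤ → Network
star L a b with a <ᵇ b
... | false = trivial L
... | true  = net 1 (concatMap edge L)
  where
  edge : ℤ → List (V 1 × V 1)
  edge i = if (a ≤ᵇ i) ∧ (i ≤ᵇ b)
             then (src i , int zero) ∷ (int zero , snk i) ∷ []
             else (src i , snk i) ∷ []

isSnk : ∀ {m} → V m → Bool
isSnk (snk _) = true
isSnk _ = false

isSrc : ∀ {m} → V m → Bool
isSrc (src _) = true
isSrc _ = false

_•_ : Network → Network → Network
net m E • net m' F' = net (m ℕ.+ m') (notSnk ++ merged ++ notSrc)
  where
  inl : Fin m → Fin (m ℕ.+ m')
  inl = F._↑ˡ m'
  inr : Fin m' → Fin (m ℕ.+ m')
  inr = m F.↑ʳ_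
  notSnk = concatMap (λ { (u , v) → if isSnk v then [] else mapE inl (u , v) ∷ [] }) E
  notSrc = concatMap (λ { (u , v) → if isSrc u then [] else mapE inr (u , v) ∷ [] }) F'
  match : V m × V m → V m' × V m' → List (V (m ℕ.+ m') × V (m ℕ.+ m'))
  match (u , snk i) (src j , w) = if i == j then (mapV inl u , mapV inr w) ∷ [] else []
  match _ _ = []
  merged = concatMap (λ e → concatMap (match e) F') E

infixr 6 _•_

Interval : Set
Interval = ℤ × ℤ

lo hi : Interval → ℤ
lo = proj₁
hi = proj₂

Nested : Interval → Interval → Set
Nested I J = lo J ≤ lo I × hi I ≤ hi J

-- [c,d] ∩ [c',d'] ≠ ∅ (endpoints are nonzero, so 0 plays no role)
Meet : Interval → Interval → Set
Meet I J = lo I ≤ hi J × lo J ≤ hi I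

DistinctNonNesting : List Interval → Set
DistinctNonNesting xs =
  Unique xs ×
  ((i j : Fin (length xs)) → i ≢ j → ¬ Nested (lookup xs i) (lookup xs j))

ZigZag : List Interval → Set
ZigZag xs = DistinctNonNesting xs ×
  ((i j k : Fin (length xs)) → i F.< j → j F.< k →
     Meet (lookup xs i) (lookup xs j) → Meet (lookup xs j) (lookup xs k) →
     (lo (lookup xs i) < lo (lookup xs j) × lo (lookup xs j) < lo (lookup xs k)) ⊎
     (lo (lookup xs i) > lo (lookup xs j) × lo (lookup xs j) > lo (lookup xs k)))

Descending : List Interval → Set
Descending xs = DistinctNonNesting xs ×
  ((i j : Fin (length xs)) → i F.< j →
     Meet (lookup xs i) (lookup xs j) → lo (lookup xs i) > lo (lookup xs j))

InA : ℤ → ℤ → Interval → Set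
InA h l I = lo I ≤ hi I × lo I ∈ labels h l × hi I ∈ labels h l

networkA : ℤ → ℤ → List Interval → Network
networkA h l [] = trivial (labels h l)
networkA h l (I ∷ xs) = star (labels h l) (lo I) (hi I) • networkA h l xs

BCInterval : ℕ → Interval → Set
BCInterval n I =
  (+ 1 ≤ lo I × lo I ≤ hi I × hi I ≤ + n) ⊎
  (+ 1 ≤ hi I × hi I ≤ + n × lo I ≡ - hi I)

labelsBC : ℕ → List ℤ
labelsBC n = labels (- + n) (+ n)

starBC : ℕ → Interval → Network
starBC n (a , b) with (+ 1) ≤ᵇ a
... | true  = star (labelsBC n) a b • star (labelsBC n) (- b) (- a)
... | false = star (labelsBC n) a b

networkBC : ℕ → List Interval → Network
networkBC n [] = trivial (labelsBC n)
networkBC n (I ∷ xs) = starBC n I • networkBC n xs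

-- Cardinality of a set of networks given as the image of the
-- sequences satisfying a predicate, networks identified up to ≅:
-- there are N representatives, pairwise non-isomorphic, and every
-- member is isomorphic to one of them.

HasSize : (P : List Interval → Set) → (List Interval → Network) → ℕ → Set
HasSize P N k =
  Σ (Fin k → List Interval) λ rep →
    ((r : Fin k) → P (rep r)) ×
    ((r s : Fin k) → N (rep r) ≅ N (rep s) → r ≡ s) ×
    ((xs : List Interval) → P xs → ∃ λ r → N xs ≅ N (rep r))

ZA DA : ℕ → List Interval → Set
ZA n xs = All (InA (+ 1) (+ suc n)) xs × ZigZag xs
DA n xs = All (InA (+ 1) (+ suc n)) xs × Descending xs

netA : ℕ → List Interval → Network
netA n = networkA (+ 1) (+ suc n)

ZBC DBC : ℕ → List Interval → Set
ZBC n xs = All (BCInterval n) xs × ZigZag xs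
DBC n xs = All (BCInterval n) xs × Descending xs

catalan : ℕ → ℕ
catalan m = ((2 ℕ.* m) C m) ℕ./ suc m

{-# OPTIONS --safe #-}
module Submission where

-- Removing trivial intervals, sequences of both types are encoded by sequences of
-- intervals of {0, …, n}: type A by a shift, while in type BC the intervals of {1, …, n}
-- stand for themselves and the symmetric interval [-b , b] for [0 , b]; containment, intersection and the order of
-- left endpoints are preserved.  A network is a bundle of wires, one per label i, running
-- through the intervals that contain i in their order of occurrence.  Hence these
-- restricted sequences determine the network.  Conversely, in a zig-zag sequence every
-- interval is joined directly to a source or sink at each of its two endpoints, so it can
-- be read off from the network; and of two meeting intervals the order is visible from
-- whether the one starting further right receives its leftmost source directly.  So in
-- both types networks correspond to the same families of restricted sequences.  In the
-- descending case these amount to chains c₁ > c₂ > …, d₁ > d₂ > … of nontrivial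
-- intervals, which are counted by ballot numbers.

open import Defs
open import Data.Bool as Bool using (true; false; if_then_else_; _∧_)
open import Data.Empty using (⊥; ⊥-elim)
open import Data.Fin as Fin using (Fin; zero; suc; splitAt; _↑ˡ_; _↑ʳ_)
import Data.Fin.Properties as Fin
open import Data.Integer as ℤ using (ℤ; +_; -[1+_]; _≤_; _<_; _≟_; _≤?_; _<?_; +≤+; -≤+; -≤-; +<+; -<+; -<-)
import Data.Integer.Properties as ℤ
open import Data.List using (List; []; _∷_; _++_; map; concatMap; filter; length; lookup; upTo; cartesianProduct; deduplicate)
open import Data.List.Membership.Propositional using (_∈_; _∉_; find)
open import Data.List.Membership.Propositional.Properties using (∈-++⁺ˡ; ∈-++⁺ʳ; ∈-++⁻; ∈-concatMap⁻; ∈-concatMap⁺; ∈-filter⁺; ∈-filter⁻; ∈-map⁺; ∈-map⁻; ∈-lookup; ∈-upTo⁺; ∈-cartesianProduct⁺; ∈-deduplicate⁻)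
open import Data.List.Properties using (map-++; ++-assoc; ++-identityʳ; concatMap-++; concatMap-map; map-concatMap; concatMap-cong; filter-++; filter-accept; filter-reject; map-∘; map-cong; map-injective; ∷-injectiveˡ; ∷-injectiveʳ; length-++; length-map; ≡-dec)
open import Data.List.Relation.Binary.Permutation.Propositional using (_↭_; refl; prep; swap; trans; ↭-sym; ↭-reflexive; module PermutationReasoning)
open import Data.List.Relation.Binary.Permutation.Propositional.Properties using (++⁺; ++⁺ˡ; shifts; map⁺; ↭-map-inv; ∈-resp-↭; All-resp-↭; filter-↭)
open import Data.List.Relation.Unary.All as All using (All; []; _∷_)
open import Data.List.Relation.Unary.AllPairs using (AllPairs; []; _∷_; allPairs?)
open import Data.List.Relation.Unary.Any as Any using (here; there)
import Data.List.Relation.Unary.Any.Properties as Any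
open import Data.List.Relation.Unary.Unique.DecSetoid.Properties using (deduplicate-!)
open import Data.List.Relation.Unary.Unique.Propositional using (Unique)
import Data.List.Relation.Unary.Unique.Propositional.Properties as Unique
open import Data.Nat as ℕ using (ℕ; zero; suc; _+_; _*_; _/_; z≤n; s≤s)
open import Data.Nat.Combinatorics using (_C_; nCn≡1; nC1≡n; nCk≡nC[n∸k]; nCk+nC[k+1]≡[n+1]C[k+1]; k>n⇒nCk≡0)
open import Data.Nat.DivMod using (m*n/n≡m)
import Data.Nat.Properties as ℕ
open import Data.Nat.Solver using (module +-*-Solver)
open import Data.Product using (Σ; ∃; ∃₂; _×_; _,_; proj₁; proj₂)
open import Data.Product.Properties using () renaming (≡-dec to ≡-dec-×)
open import Data.Sum as Sum using (_⊎_; inj₁; inj₂; [_,_]′)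
open import Function using (_∘_)
open import Function.Bundles using (Inverse; mk↔ₛ′)
open import Relation.Binary.Bundles using (DecSetoid)
import Relation.Binary.Construct.On as On
open import Relation.Binary.Definitions using (tri<; tri≈; tri>)
open import Relation.Binary.PropositionalEquality as ≡ using (_≡_; _≢_; cong; cong₂; subst; sym)
open import Relation.Nullary using (¬_; Dec; yes; no; does; contradiction)
open import Relation.Nullary.Decidable using (_×-dec_; dec-true; dec-false; ¬?; _→-dec_; _⊎-dec_)
open import Relation.Unary using (Decidable)

-- In type BC a star and its mirror image order left endpoints oppositely, so the stars that make up
-- a descending sequence need not descend. The zig-zag condition survives reflection. Hence networks
-- are decoded for zig-zag sequences only, and the descending case enters through inclusion, in both
-- types. An isomorphism is known to fix only the labels of sources and sinks; that corresponding
-- interior vertices belong to the same interval has to be proved, from the boundary vertices next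
-- to them. Entries of a sequence are distinct, so lengths are bounded and the zig-zag sequences can
-- be listed; keeping one for each family of restrictions gives a number that serves both types.
-- Type BC has no label 0, but what passes through 0 can be read off at label 1.

-- Concatenation

module _ {A B : Set} where

  concatMap-↭ : (f : A → List B) {xs ys : List A} → xs ↭ ys → concatMap f xs ↭ concatMap f ys
  concatMap-↭ f refl         = refl
  concatMap-↭ f (prep x p)   = ++⁺ˡ (f x) (concatMap-↭ f p)
  concatMap-↭ f (swap x y p) = trans (shifts (f x) (f y)) (++⁺ˡ (f y) (++⁺ˡ (f x) (concatMap-↭ f p)))
  concatMap-↭ f (trans p q)  = trans (concatMap-↭ f p) (concatMap-↭ f q)

  concatMap-cong-↭ : {f g : A → List B} → (∀ x → f x ↭ g x) → ∀ xs → concatMap f xs ↭ concatMap g xs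
  concatMap-cong-↭ f↭g []       = refl
  concatMap-cong-↭ f↭g (x ∷ xs) = ++⁺ (f↭g x) (concatMap-cong-↭ f↭g xs)

  concatMap-++-↭ : (f g : A → List B) (xs : List A) →
    concatMap f xs ++ concatMap g xs ↭ concatMap (λ x → f x ++ g x) xs
  concatMap-++-↭ f g []       = refl
  concatMap-++-↭ f g (x ∷ xs) = begin
    (f x ++ concatMap f xs) ++ (g x ++ concatMap g xs)  ≡⟨ ++-assoc (f x) _ _ ⟩
    f x ++ (concatMap f xs ++ (g x ++ concatMap g xs))  ↭⟨ ++⁺ˡ (f x) (shifts (concatMap f xs) (g x)) ⟩
    f x ++ (g x ++ (concatMap f xs ++ concatMap g xs))  ≡⟨ ++-assoc (f x) (g x) _ ⟨
    (f x ++ g x) ++ (concatMap f xs ++ concatMap g xs)  ↭⟨ ++⁺ˡ (f x ++ g x) (concatMap-++-↭ f g xs) ⟩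
    (f x ++ g x) ++ concatMap (λ x → f x ++ g x) xs     ∎
    where open PermutationReasoning

  concatMap-[] : (f : A → List B) → (∀ x → f x ≡ []) → ∀ xs → concatMap f xs ≡ []
  concatMap-[] f f≡[] []       = ≡.refl
  concatMap-[] f f≡[] (x ∷ xs) rewrite f≡[] x = concatMap-[] f f≡[] xs

  concatMap-cong-local : {f g : A → List B} {xs : List A} → (∀ {x} → x ∈ xs → f x ≡ g x) →
    concatMap f xs ≡ concatMap g xs
  concatMap-cong-local {xs = []}     f≡g = ≡.refl
  concatMap-cong-local {xs = x ∷ xs} f≡g = cong₂ _++_ (f≡g (here ≡.refl)) (concatMap-cong-local (f≡g ∘ there))

  concatMap-[-] : (f : A → B) → ∀ xs → concatMap (λ x → f x ∷ []) xs ≡ map f xs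
  concatMap-[-] f []       = ≡.refl
  concatMap-[-] f (x ∷ xs) = cong (f x ∷_) (concatMap-[-] f xs)

module _ {A B C : Set} where

  concatMap-concatMap : (g : B → List C) (f : A → List B) → ∀ xs →
    concatMap g (concatMap f xs) ≡ concatMap (λ x → concatMap g (f x)) xs
  concatMap-concatMap g f []       = ≡.refl
  concatMap-concatMap g f (x ∷ xs) =
    ≡.trans (concatMap-++ g (f x) (concatMap f xs)) (cong (concatMap g (f x) ++_) (concatMap-concatMap g f xs))

map-concatMap-∘ : {A B C D : Set} {f : A → List B} {g : B → D} {h : A → C} {f′ : C → List D} →
  (∀ x → map g (f x) ≡ f′ (h x)) → ∀ xs → map g (concatMap f xs) ≡ concatMap f′ (map h xs)
map-concatMap-∘ {f = f} {g} {h} {f′} eq xs =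
  ≡.trans (map-concatMap g f xs) (≡.trans (concatMap-cong eq xs) (sym (concatMap-map f′ h xs)))

-- This is where distinct labels matter: the edge into sink `i` meets exactly one edge out of source
-- `i`.
concatMap-select : {B : Set} (b : ℤ → B) {i : ℤ} {L : List ℤ} → Unique L → i ∈ L →
  concatMap (λ j → if does (i ≟ j) then b j ∷ [] else []) L ≡ b i ∷ []
concatMap-select b {i} {.i ∷ L} (i∉L ∷ _) (here ≡.refl) rewrite dec-true (i ≟ i) ≡.refl =
  cong (b i ∷_) (≡.trans (concatMap-cong-local (none i∉L)) (concatMap-[] (λ _ → []) (λ _ → ≡.refl) L))
  where
  none : ∀ {L} → All (i ≢_) L → ∀ {j} → j ∈ L → (if does (i ≟ j) then b j ∷ [] else []) ≡ []
  none i∉L {j} j∈L rewrite dec-false (i ≟ j) (All.lookup i∉L j∈L) = ≡.refl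
concatMap-select b {i} {j ∷ L} (j∉L ∷ u) (there i∈L)
  rewrite dec-false (i ≟ j) (λ { ≡.refl → All.lookup j∉L i∈L ≡.refl }) = concatMap-select b u i∈L

-- Networks whose interior vertices are named by elements of X

data Vertex (X : Set) : Set where
  source sink : ℤ → Vertex X
  inner       : X → Vertex X

Edge : Set → Set
Edge X = Vertex X × Vertex X

module _ {X : Set} where

  links : Vertex X → List X → ℤ → List (Edge X)
  links u []       i = (u , sink i) ∷ []
  links u (x ∷ xs) i = (u , inner x) ∷ links (inner x) xs i

  wire : ℤ → List X → List (Edge X)
  wire i xs = links (source i) xs i

  dropSink dropSource : Edge X → List (Edge X)
  dropSink (u , sink _) = []
  dropSink e            = e ∷ []
  dropSource (source _ , v) = []
  dropSource e              = e ∷ []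

  join : Edge X → Edge X → List (Edge X)
  join (u , sink i) (source j , v) = if does (i ≟ j) then (u , v) ∷ [] else []
  join _            _              = []

  -- The edge list of `•` for two networks whose interior vertices are already named in a common
  -- set, so that no reindexing of `Fin` intervenes.
  compose : List (Edge X) → List (Edge X) → List (Edge X)
  compose E F = concatMap dropSink E ++ concatMap (λ e → concatMap (join e) F) E ++ concatMap dropSource F

  compose-↭ : ∀ {E E′ F F′} → E ↭ E′ → F ↭ F′ → compose E F ↭ compose E′ F′
  compose-↭ {E′ = E′} p q = ++⁺ (concatMap-↭ dropSink p)
    (++⁺ (trans (concatMap-↭ _ p) (concatMap-cong-↭ (λ e → concatMap-↭ (join e) q) E′))
         (concatMap-↭ dropSource q))

  -- A path is cut for merging: `front` is a path without its edge into the sink, `back` one without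
  -- its edge out of the source, and the merged edge runs from `last` to `first`.
  front : Vertex X → List X → List (Edge X)
  front u []       = []
  front u (x ∷ xs) = (u , inner x) ∷ front (inner x) xs

  last : Vertex X → List X → Vertex X
  last u []       = u
  last u (x ∷ xs) = last (inner x) xs

  first : List X → ℤ → Vertex X
  first []       i = sink i
  first (x ∷ xs) i = inner x

  back : List X → ℤ → List (Edge X)
  back []       i = []
  back (x ∷ xs) i = links (inner x) xs i

  links-++ : ∀ u xs ys i → front u xs ++ ((last u xs , first ys i) ∷ []) ++ back ys i ≡ links u (xs ++ ys) i
  links-++ u []       []       i = ≡.refl
  links-++ u []       (y ∷ ys) i = ≡.refl
  links-++ u (x ∷ xs) ys       i = cong (_ ∷_) (links-++ (inner x) xs ys i)

  dropSink-links : ∀ u xs i → concatMap dropSink (links u xs i) ≡ front u xs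
  dropSink-links u []       i = ≡.refl
  dropSink-links u (x ∷ xs) i = cong (_ ∷_) (dropSink-links (inner x) xs i)

  dropSource-links : ∀ x xs i → concatMap dropSource (links (inner x) xs i) ≡ links (inner x) xs i
  dropSource-links x []       i = ≡.refl
  dropSource-links x (y ∷ xs) i = cong (_ ∷_) (dropSource-links y xs i)

  dropSource-wire : ∀ xs i → concatMap dropSource (wire i xs) ≡ back xs i
  dropSource-wire []       i = ≡.refl
  dropSource-wire (x ∷ xs) i = dropSource-links x xs i

  join-links : ∀ u xs i F →
    concatMap (λ e → concatMap (join e) F) (links u xs i) ≡ concatMap (join (last u xs , sink i)) F
  join-links u []       i F = ++-identityʳ _
  join-links u (x ∷ xs) i F
    rewrite concatMap-[] (join (u , inner x)) (λ _ → ≡.refl) F = join-links (inner x) xs i F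

  join-inner : ∀ u i x xs j → concatMap (join (u , sink i)) (links (inner x) xs j) ≡ []
  join-inner u i x []       j = ≡.refl
  join-inner u i x (y ∷ xs) j = join-inner u i y xs j

  join-wire : ∀ u i xs j →
    concatMap (join (u , sink i)) (wire j xs) ≡ (if does (i ≟ j) then (u , first xs j) ∷ [] else [])
  join-wire u i []       j = ++-identityʳ _
  join-wire u i (x ∷ xs) j rewrite join-inner u i x xs j = ++-identityʳ _

  -- Label by label the two paths are concatenated. The result holds only up to permutation, because
  -- composition lists kept and merged edges in separate blocks rather than by label.
  compose-wires : ∀ {L} → Unique L → (w w′ : ℤ → List X) →
    compose (concatMap (λ i → wire i (w i)) L) (concatMap (λ i → wire i (w′ i)) L) ↭
    concatMap (λ i → wire i (w i ++ w′ i)) L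
  compose-wires {L} unique w w′ = begin
    compose (concatMap (λ i → wire i (w i)) L) F
      ≡⟨ cong₂ _++_
           (≡.trans (concatMap-concatMap dropSink _ L) (concatMap-cong (λ i → dropSink-links (source i) (w i) i) L))
           (cong₂ _++_ (≡.trans (concatMap-concatMap _ _ L) (concatMap-cong-local joined))
             (≡.trans (concatMap-concatMap dropSource _ L) (concatMap-cong (λ i → dropSource-wire (w′ i) i) L))) ⟩
    concatMap fr L ++ concatMap mid L ++ concatMap bk L
      ↭⟨ ++⁺ˡ (concatMap fr L) (concatMap-++-↭ mid bk L) ⟩
    concatMap fr L ++ concatMap (λ i → mid i ++ bk i) L
      ↭⟨ concatMap-++-↭ fr (λ i → mid i ++ bk i) L ⟩
    concatMap (λ i → fr i ++ mid i ++ bk i) L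
      ≡⟨ concatMap-cong (λ i → links-++ (source i) (w i) (w′ i) i) L ⟩
    concatMap (λ i → wire i (w i ++ w′ i)) L ∎
    where
    open PermutationReasoning
    F = concatMap (λ i → wire i (w′ i)) L
    fr mid bk : ℤ → List (Edge X)
    fr i  = front (source i) (w i)
    mid i = (last (source i) (w i) , first (w′ i) i) ∷ []
    bk i  = back (w′ i) i
    joined : ∀ {i} → i ∈ L → concatMap (λ e → concatMap (join e) F) (wire i (w i)) ≡ mid i
    joined {i} i∈L = ≡.trans (join-links (source i) (w i) i F)
      (≡.trans (concatMap-concatMap (join (l , sink i)) _ L)
      (≡.trans (concatMap-cong (λ j → join-wire l i (w′ j) j) L)
               (concatMap-select (λ j → l , first (w′ j) j) unique i∈L)))
      where l = last (source i) (w i)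

  label : ∀ {m} → (Fin m → X) → V m → Vertex X
  label f (src i) = source i
  label f (snk i) = sink i
  label f (int k) = inner (f k)

  labelE : ∀ {m} → (Fin m → X) → V m × V m → Edge X
  labelE f (u , v) = label f u , label f v

  label-injective : ∀ {m} {f : Fin m → X} → (∀ {k l} → f k ≡ f l → k ≡ l) →
    ∀ {u v} → label f u ≡ label f v → u ≡ v
  label-injective inj {src _} {src _} ≡.refl = ≡.refl
  label-injective inj {snk _} {snk _} ≡.refl = ≡.refl
  label-injective inj {int k} {int l} eq     = cong int (inj (inner-injective eq))
    where
    inner-injective : ∀ {x y} → inner x ≡ inner y → x ≡ y
    inner-injective ≡.refl = ≡.refl

  labelE-injective : ∀ {m} {f : Fin m → X} → (∀ {k l} → f k ≡ f l → k ≡ l) →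
    ∀ {e e′} → labelE f e ≡ labelE f e′ → e ≡ e′
  labelE-injective inj eq = cong₂ _,_ (label-injective inj (cong proj₁ eq)) (label-injective inj (cong proj₂ eq))

  label-mapV : ∀ {m m′} {f : Fin m → X} {g : Fin m′ → X} {h : Fin m → Fin m′} →
    (∀ k → g (h k) ≡ f k) → ∀ v → label g (mapV h v) ≡ label f v
  label-mapV eq (src i) = ≡.refl
  label-mapV eq (snk i) = ≡.refl
  label-mapV eq (int k) = cong inner (eq k)

  labelE-mapE : ∀ {m m′} {f : Fin m → X} {g : Fin m′ → X} {h : Fin m → Fin m′} →
    (∀ k → g (h k) ≡ f k) → ∀ e → labelE g (mapE h e) ≡ labelE f e
  labelE-mapE eq (u , v) = cong₂ _,_ (label-mapV eq u) (label-mapV eq v)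

  _⊎ˡ_ : ∀ {m m′} → (Fin m → X) → (Fin m′ → X) → Fin (m + m′) → X
  _⊎ˡ_ {m} f g k = [ f , g ]′ (splitAt m k)

  ⊎ˡ-↑ˡ : ∀ {m m′} (f : Fin m → X) (g : Fin m′ → X) k → (f ⊎ˡ g) (k ↑ˡ m′) ≡ f k
  ⊎ˡ-↑ˡ {m} {m′} f g k rewrite Fin.splitAt-↑ˡ m k m′ = ≡.refl

  ⊎ˡ-↑ʳ : ∀ {m m′} (f : Fin m → X) (g : Fin m′ → X) k → (f ⊎ˡ g) (m ↑ʳ k) ≡ g k
  ⊎ˡ-↑ʳ {m} {m′} f g k rewrite Fin.splitAt-↑ʳ m m′ k = ≡.refl

  labelled-• : ∀ N N′ (f : Fin (nInt N) → X) (g : Fin (nInt N′) → X) →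
    map (labelE (f ⊎ˡ g)) (edges (N • N′)) ≡ compose (map (labelE f) (edges N)) (map (labelE g) (edges N′))
  labelled-• N@(net m E) N′@(net m′ F) f g =
    ≡.trans (map-++ lab (concatMap _ E) _) (cong₂ _++_
      (map-concatMap-∘ (λ { (u , src _) → cong (_∷ []) (left _)
                          ; (u , snk _) → ≡.refl
                          ; (u , int _) → cong (_∷ []) (left _) }) E)
      (≡.trans (map-++ lab (concatMap _ E) _) (cong₂ _++_
        (map-concatMap-∘ (λ { (u , src _) → map-concatMap-∘ (λ _ → ≡.refl) F
                              ; (u , int _) → map-concatMap-∘ (λ _ → ≡.refl) F
                              ; (u , snk i) → map-concatMap-∘ (λ { (src j , v) → merged u i j v
                                                                 ; (snk _ , v) → ≡.refl
                                                                 ; (int _ , v) → ≡.refl }) F }) E)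
        (map-concatMap-∘ (λ { (src _ , v) → ≡.refl
                            ; (snk _ , v) → cong (_∷ []) (right _)
                            ; (int _ , v) → cong (_∷ []) (right _) }) F))))
    where
    lab = labelE (f ⊎ˡ g)
    left : ∀ e → lab (mapE (_↑ˡ m′) e) ≡ labelE f e
    left = labelE-mapE (⊎ˡ-↑ˡ f g)
    right : ∀ e → lab (mapE (m ↑ʳ_) e) ≡ labelE g e
    right = labelE-mapE (⊎ˡ-↑ʳ f g)
    merged : ∀ u i j v →
      map lab (if i == j then (mapV (_↑ˡ m′) u , mapV (m ↑ʳ_) v) ∷ [] else []) ≡
      join (label f u , sink i) (source j , label g v)
    merged u i j v with i ≟ j
    ... | yes _ = cong (_∷ []) (cong₂ _,_ (label-mapV (⊎ˡ-↑ˡ f g) u) (label-mapV (⊎ˡ-↑ʳ f g) v))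
    ... | no  _ = ≡.refl

-- Networks realizing a sequence of intervals

_∋_ : Interval → ℤ → Set
I ∋ i = lo I ≤ i × i ≤ hi I

∋? : ∀ i → Decidable (_∋ i)
∋? i I = (lo I ≤? i) ×-dec (i ≤? hi I)

through : ℤ → List Interval → List Interval
through i = filter (∋? i)

wires : List ℤ → List Interval → List (Edge Interval)
wires L S = concatMap (λ i → wire i (through i S)) L

-- N consists of one interior vertex per interval of S, the wire i ∈ L
-- running through the intervals that contain i in their order in S.
record Realizes (L : List ℤ) (N : Network) (S : List Interval) : Set where
  field
    name           : Fin (nInt N) → Interval
    name-injective : ∀ {k l} → name k ≡ name l → k ≡ l
    name-∈         : ∀ k → name k ∈ S
    vertex         : ∀ {I} → I ∈ S → ∃ λ k → name k ≡ I
    edges-↭        : map (labelE name) (edges N) ↭ wires L S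
open Realizes

trivial-realizes : ∀ L → Realizes L (trivial L) []
trivial-realizes L = record
  { name           = λ ()
  ; name-injective = λ { {()} }
  ; name-∈         = λ ()
  ; vertex         = λ ()
  ; edges-↭        = ↭-reflexive (≡.trans (sym (map-∘ L)) (sym (concatMap-[-] _ L)))
  }

star-realizes : ∀ L {a b} → a < b → Realizes L (star L a b) ((a , b) ∷ [])
star-realizes L {a} {b} a<b rewrite dec-true (a <? b) a<b = record
  { name           = λ _ → a , b
  ; name-injective = λ { {zero} {zero} _ → ≡.refl }
  ; name-∈         = λ _ → here ≡.refl
  ; vertex         = λ { (here ≡.refl) → zero , ≡.refl }
  ; edges-↭        = ↭-reflexive (≡.trans (map-concatMap _ _ L) (concatMap-cong same L))
  }
  where
  same : ∀ i → map (labelE (λ _ → a , b)) (if (a ≤ᵇ i) ∧ (i ≤ᵇ b)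
                  then (src i , int zero) ∷ (int zero , snk i) ∷ [] else (src i , snk i) ∷ []) ≡ wire i (through i ((a , b) ∷ []))
  same i with a ≤? i | i ≤? b
  ... | yes _ | yes _ = ≡.refl
  ... | yes _ | no  _ = ≡.refl
  ... | no  _ | yes _ = ≡.refl
  ... | no  _ | no  _ = ≡.refl

-- This is how trivial intervals vanish from the encoding: their star has no interior vertex.
star-realizes-[] : ∀ L {a b} → ¬ a < b → Realizes L (star L a b) []
star-realizes-[] L {a} {b} a≮b rewrite dec-false (a <? b) a≮b = trivial-realizes L

-- Restriction to a label commutes with `++`, so `compose-wires` gives the edges. Disjointness keeps
-- the naming of interior vertices by intervals injective.
•-realizes : ∀ {L N N′ S S′} → Unique L → (∀ {I} → I ∈ S → I ∈ S′ → ⊥) →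
  Realizes L N S → Realizes L N′ S′ → Realizes L (N • N′) (S ++ S′)
•-realizes {L} {N} {N′} {S} {S′} unique disjoint R R′ = record
  { name           = nm
  ; name-injective = λ {k} {l} → inj k l
  ; name-∈         = nm-∈
  ; vertex         = vx
  ; edges-↭        = begin
      map (labelE nm) (edges (N • N′))
        ≡⟨ labelled-• N N′ (name R) (name R′) ⟩
      compose (map (labelE (name R)) (edges N)) (map (labelE (name R′)) (edges N′))
        ↭⟨ compose-↭ (edges-↭ R) (edges-↭ R′) ⟩
      compose (wires L S) (wires L S′)
        ↭⟨ compose-wires unique (λ i → through i S) (λ i → through i S′) ⟩
      concatMap (λ i → wire i (through i S ++ through i S′)) L
        ≡⟨ concatMap-cong (λ i → cong (wire i) (filter-++ (∋? i) S S′)) L ⟨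
      wires L (S ++ S′) ∎
  }
  where
  open PermutationReasoning
  nm = name R ⊎ˡ name R′
  inj : ∀ k l → nm k ≡ nm l → k ≡ l
  inj k l eq with splitAt (nInt N) k in p | splitAt (nInt N) l in q
  ... | inj₁ k′ | inj₁ l′ = ≡.trans (sym (Fin.splitAt⁻¹-↑ˡ p))
          (≡.trans (cong (_↑ˡ nInt N′) (name-injective R eq)) (Fin.splitAt⁻¹-↑ˡ q))
  ... | inj₂ k′ | inj₂ l′ = ≡.trans (sym (Fin.splitAt⁻¹-↑ʳ p))
          (≡.trans (cong (nInt N ↑ʳ_) (name-injective R′ eq)) (Fin.splitAt⁻¹-↑ʳ q))
  ... | inj₁ k′ | inj₂ l′ = ⊥-elim (disjoint (name-∈ R k′) (subst (_∈ S′) (sym eq) (name-∈ R′ l′)))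
  ... | inj₂ k′ | inj₁ l′ = ⊥-elim (disjoint (name-∈ R l′) (subst (_∈ S′) eq (name-∈ R′ k′)))
  nm-∈ : ∀ k → nm k ∈ S ++ S′
  nm-∈ k with splitAt (nInt N) k
  ... | inj₁ k′ = ∈-++⁺ˡ (name-∈ R k′)
  ... | inj₂ k′ = ∈-++⁺ʳ S (name-∈ R′ k′)
  vx : ∀ {I} → I ∈ S ++ S′ → ∃ λ k → nm k ≡ I
  vx I∈ with ∈-++⁻ S I∈
  ... | inj₁ I∈S  with vertex R I∈S
  ...   | k , eq = k ↑ˡ nInt N′ , ≡.trans (⊎ˡ-↑ˡ (name R) (name R′) k) eq
  vx I∈ | inj₂ I∈S′ with vertex R′ I∈S′
  ...   | k , eq = nInt N ↑ʳ k , ≡.trans (⊎ˡ-↑ʳ (name R) (name R′) k) eq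

SameMembers : {A : Set} → List A → List A → Set
SameMembers xs ys = (∀ {x} → x ∈ xs → x ∈ ys) × (∀ {x} → x ∈ ys → x ∈ xs)

-- Vertices with equal names correspond. The edge lists agree after naming, and naming is injective
-- on edges, so the agreement can be pulled back.
realizes-≅ : ∀ {L N N′ S S′} → Realizes L N S → Realizes L N′ S′ →
  SameMembers S S′ → wires L S ↭ wires L S′ → N ≅ N′
realizes-≅ {N = N} {N′} R R′ (S⊆S′ , S′⊆S) p = mk↔ₛ′ to from to-from from-to , edges-match
  where
  to   = λ k → proj₁ (vertex R′ (S⊆S′ (name-∈ R k)))
  from = λ k → proj₁ (vertex R  (S′⊆S (name-∈ R′ k)))
  name-to : ∀ k → name R′ (to k) ≡ name R k
  name-to k = proj₂ (vertex R′ (S⊆S′ (name-∈ R k)))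
  name-from : ∀ k → name R (from k) ≡ name R′ k
  name-from k = proj₂ (vertex R (S′⊆S (name-∈ R′ k)))
  to-from : ∀ k → to (from k) ≡ k
  to-from k = name-injective R′ (≡.trans (name-to (from k)) (name-from k))
  from-to : ∀ k → from (to k) ≡ k
  from-to k = name-injective R (≡.trans (name-from (to k)) (name-to k))
  relabelled : map (labelE (name R′)) (map (mapE to) (edges N)) ↭ map (labelE (name R′)) (edges N′)
  relabelled = trans (↭-reflexive (≡.trans (sym (map-∘ (edges N))) (map-cong (labelE-mapE name-to) (edges N))))
    (trans (edges-↭ R) (trans p (↭-sym (edges-↭ R′))))
  edges-match : map (mapE to) (edges N) ↭ edges N′
  edges-match with ↭-map-inv (labelE (name R′)) relabelled
  ... | es , eq , q = subst (_ ↭_) (sym (map-injective (labelE-injective (name-injective R′)) eq)) q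

-- Order of occurrence in a list

data Before {A : Set} (x y : A) : List A → Set where
  here  : ∀ {xs} → y ∈ xs → Before x y (x ∷ xs)
  there : ∀ {z xs} → Before x y xs → Before x y (z ∷ xs)

module _ {A : Set} where

  Before-∈ˡ : ∀ {x y : A} {xs} → Before x y xs → x ∈ xs
  Before-∈ˡ (here _)  = here ≡.refl
  Before-∈ˡ (there b) = there (Before-∈ˡ b)

  Before-∈ʳ : ∀ {x y : A} {xs} → Before x y xs → y ∈ xs
  Before-∈ʳ (here p)  = there p
  Before-∈ʳ (there b) = there (Before-∈ʳ b)

  module _ {P : A → Set} (P? : Decidable P) where

    Before-filter⁻ : ∀ {x y} xs → Before x y (filter P? xs) → Before x y xs × P x × P y
    Before-filter⁻ (z ∷ xs) b with P? z
    Before-filter⁻ (z ∷ xs) (here p)  | yes Pz with ∈-filter⁻ P? {xs = xs} p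
    ... | y∈ , Py = here y∈ , Pz , Py
    Before-filter⁻ (z ∷ xs) (there b) | yes _ with Before-filter⁻ xs b
    ... | b′ , Px , Py = there b′ , Px , Py
    Before-filter⁻ (z ∷ xs) b         | no  _ with Before-filter⁻ xs b
    ... | b′ , Px , Py = there b′ , Px , Py

    Before-filter⁺ : ∀ {x y xs} → Before x y xs → P x → P y → Before x y (filter P? xs)
    Before-filter⁺ {x} (here p) Px Py with P? x
    ... | yes _  = here (∈-filter⁺ P? p Py)
    ... | no ¬Px = contradiction Px ¬Px
    Before-filter⁺ (there {z} b) Px Py with P? z
    ... | yes _ = there (Before-filter⁺ b Px Py)
    ... | no  _ = Before-filter⁺ b Px Py

  head-or-later : ∀ {x : A} {xs} → x ∈ xs → (∃ λ ys → xs ≡ x ∷ ys) ⊎ ∃ λ y → Before y x xs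
  head-or-later (here ≡.refl) = inj₁ (_ , ≡.refl)
  head-or-later (there p)     = inj₂ (_ , here p)

  -- If the heads differed, each would come after the other in one of the lists, against asymmetry.
  -- Asymmetry also excludes repetitions, so the tails again have the same members.
  ordered-unique : {R : A → A → Set} → (∀ {x y} → R x y → R y x → ⊥) → ∀ {xs ys} →
    (∀ {x y} → Before x y xs → R x y) → (∀ {x y} → Before x y ys → R x y) →
    SameMembers xs ys → xs ≡ ys
  ordered-unique asym {[]}     {[]}     _ _ _ = ≡.refl
  ordered-unique asym {[]}     {y ∷ ys} _ _ (_ , g) with g (here ≡.refl)
  ... | ()
  ordered-unique asym {x ∷ xs} {[]}     _ _ (f , _) with f (here ≡.refl)
  ... | ()
  ordered-unique {R} asym {x ∷ xs} {y ∷ ys} Rxs Rys (f , g) with heads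
    where
    heads : x ≡ y
    heads with f (here ≡.refl) | g (here ≡.refl)
    ... | here eq | _         = eq
    ... | there _ | here eq   = sym eq
    ... | there p | there q   = ⊥-elim (asym (Rxs (here q)) (Rys (here p)))
  ... | ≡.refl = cong (x ∷_) (ordered-unique asym (Rxs ∘ there) (Rys ∘ there)
      ( (λ p → tail (f (there p)) (λ { ≡.refl → irrefl (Rxs (here p)) }))
      , (λ p → tail (g (there p)) (λ { ≡.refl → irrefl (Rys (here p)) }))))
    where
    irrefl : ∀ {z} → R z z → ⊥
    irrefl r = asym r r
    tail : ∀ {w z : A} {zs} → w ∈ z ∷ zs → w ≢ z → w ∈ zs
    tail (here eq) ne = ⊥-elim (ne eq)
    tail (there p) ne = p

-- Edges of a wire at its source and at its sink

module _ {X : Set} where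

  source∈wire⁻ : ∀ {i j} {x : X} xs → (source i , inner x) ∈ wire j xs → i ≡ j × ∃ λ ys → xs ≡ x ∷ ys
  source∈wire⁻ (x ∷ xs) (here ≡.refl) = ≡.refl , xs , ≡.refl
  source∈wire⁻ {i} (x ∷ xs) (there p) = ⊥-elim (absent x xs p)
    where
    absent : ∀ {j v} x xs → (source i , v) ∈ links (inner x) xs j → ⊥
    absent x (y ∷ xs) (there p) = absent y xs p
    absent x [] (here ())
    absent x [] (there ())
  source∈wire⁻ [] (here ())
  source∈wire⁻ [] (there ())

  sink∈links⁻ : ∀ {u i j} {x : X} xs → (inner x , sink i) ∈ links u xs j →
    i ≡ j × (u ≡ inner x ⊎ x ∈ xs)
  sink∈links⁻ [] (here ≡.refl) = ≡.refl , inj₁ ≡.refl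
  sink∈links⁻ (y ∷ xs) (there p) with sink∈links⁻ xs p
  ... | eq , inj₁ ≡.refl = eq , inj₂ (here ≡.refl)
  ... | eq , inj₂ q      = eq , inj₂ (there q)

  sink∈links⁺ : ∀ {u i} {x : X} {xs} → x ∈ xs → (inner x , sink i) ∈ links u xs i ⊎ ∃ λ y → Before x y xs
  sink∈links⁺ {xs = x ∷ []}     (here ≡.refl) = inj₁ (there (here ≡.refl))
  sink∈links⁺ {xs = x ∷ y ∷ xs} (here ≡.refl) = inj₂ (y , here (here ≡.refl))
  sink∈links⁺ {xs = x ∷ xs}     (there p) with sink∈links⁺ p
  ... | inj₁ q       = inj₁ (there q)
  ... | inj₂ (y , b) = inj₂ (y , there b)

module _ (L : List ℤ) (S : List Interval) where

  ∈-wires⁺ : ∀ {i e} → i ∈ L → e ∈ wire i (through i S) → e ∈ wires L S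
  ∈-wires⁺ i∈L p = ∈-concatMap⁺ _ (Any.map (λ { ≡.refl → p }) i∈L)

  ∈-wires⁻ : ∀ {e} → e ∈ wires L S → ∃ λ i → i ∈ L × e ∈ wire i (through i S)
  ∈-wires⁻ p = find (∈-concatMap⁻ _ {xs = L} p)

  source∈wires⁻ : ∀ {i I} → (source i , inner I) ∈ wires L S → ∃ λ T → through i S ≡ I ∷ T
  source∈wires⁻ p with ∈-wires⁻ p
  ... | j , _ , q with source∈wire⁻ (through j S) q
  ...   | ≡.refl , T , eq = T , eq

  source∈wires⇒∋ : ∀ {i I} → (source i , inner I) ∈ wires L S → I ∋ i
  source∈wires⇒∋ {i} {I} p with source∈wires⁻ p
  ... | T , eq = proj₂ (∈-filter⁻ (∋? i) {xs = S} (subst (I ∈_) (sym eq) (here ≡.refl)))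

  sink∈wires⇒∋ : ∀ {i I} → (inner I , sink i) ∈ wires L S → I ∋ i
  sink∈wires⇒∋ {i} p with ∈-wires⁻ p
  ... | j , _ , q with sink∈links⁻ (through j S) q
  ...   | ≡.refl , inj₂ r = proj₂ (∈-filter⁻ (∋? j) {xs = S} r)

  source∈wires⁺ : ∀ {i I} → i ∈ L → I ∈ S → I ∋ i →
    (source i , inner I) ∈ wires L S ⊎ ∃ λ K → Before K I S × K ∋ i
  source∈wires⁺ {i} i∈L I∈S I∋i with head-or-later (∈-filter⁺ (∋? i) I∈S I∋i)
  ... | inj₁ (T , eq) = inj₁ (∈-wires⁺ i∈L (subst (λ T → _ ∈ wire i T) (sym eq) (here ≡.refl)))
  ... | inj₂ (K , b) with Before-filter⁻ (∋? i) S b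
  ...   | b′ , K∋i , _ = inj₂ (K , b′ , K∋i)

  sink∈wires⁺ : ∀ {i I} → i ∈ L → I ∈ S → I ∋ i →
    (inner I , sink i) ∈ wires L S ⊎ ∃ λ K → Before I K S × K ∋ i
  sink∈wires⁺ {i} i∈L I∈S I∋i with sink∈links⁺ (∈-filter⁺ (∋? i) I∈S I∋i)
  ... | inj₁ p = inj₁ (∈-wires⁺ i∈L p)
  ... | inj₂ (K , b) with Before-filter⁻ (∋? i) S b
  ...   | b′ , _ , K∋i = inj₂ (K , b′ , K∋i)

-- Recovering a zig-zag sequence from its network

-- The zig-zag conditions by order of occurrence instead of positions, which passes to restrictions
-- and concatenations without index arithmetic. The case `I = J` of `nonNesting` contains
-- distinctness.
record Zig (S : List Interval) : Set where
  field
    nonNesting : ∀ {I J} → Before I J S → ¬ Nested I J × ¬ Nested J I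
    monotone   : ∀ {I J K} → Before I J S → Before J K S → Meet I J → Meet J K →
                 (lo I < lo J × lo J < lo K) ⊎ (lo J < lo I × lo K < lo J)

Within : List ℤ → List Interval → Set
Within L S = ∀ {I} → I ∈ S → lo I ≤ hi I × lo I ∈ L × hi I ∈ L

common⇒Meet : ∀ {I J i} → I ∋ i → J ∋ i → Meet I J
common⇒Meet (a , b) (c , d) = ℤ.≤-trans a d , ℤ.≤-trans c b

head-∉-tail : ∀ {S i I T} → Zig S → through i S ≡ I ∷ T → ¬ I ∈ T
head-∉-tail {S} {i} {I} zig eq p = proj₁ (Zig.nonNesting zig (proj₁ (Before-filter⁻ (∋? i) S (subst (Before I I) (sym eq) (here p)))))
  (ℤ.≤-refl , ℤ.≤-refl)

through-head : ∀ {S i I T} → Zig S → through i S ≡ I ∷ T → ∀ {K} → Before K I S → K ∋ i → I ∋ i → ⊥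
through-head {S} {i} {I} {T} zig eq b K∋i I∋i
  with subst (Before _ I) eq (Before-filter⁺ (∋? i) b K∋i I∋i)
... | here p   = head-∉-tail zig eq p
... | there b′ = head-∉-tail zig eq (Before-∈ʳ b′)

module _ {L S} (zig : Zig S) (within : Within L S) where

  Boundary : Interval → ℤ → Set
  Boundary I i = (source i , inner I) ∈ wires L S ⊎ (inner I , sink i) ∈ wires L S

  -- An earlier and a later interval containing lo I would lie on the same side of I.
  lo-boundary : ∀ {I} → I ∈ S → Boundary I (lo I)
  lo-boundary {I} I∈S with within I∈S
  ... | lo≤hi , lo∈L , _ with source∈wires⁺ L S lo∈L I∈S (ℤ.≤-refl , lo≤hi) | sink∈wires⁺ L S lo∈L I∈S (ℤ.≤-refl , lo≤hi)
  ... | inj₁ p | _      = inj₁ p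
  ... | inj₂ _ | inj₁ q = inj₂ q
  ... | inj₂ (K , b , K∋) | inj₂ (K′ , b′ , K′∋)
      with Zig.monotone zig b b′ (common⇒Meet K∋ (ℤ.≤-refl , lo≤hi)) (common⇒Meet (ℤ.≤-refl , lo≤hi) K′∋)
  ... | inj₁ (_ , l) = contradiction (proj₁ K′∋) (ℤ.<⇒≱ l)
  ... | inj₂ (l , _) = contradiction (proj₁ K∋) (ℤ.<⇒≱ l)

  -- Suppose `K` before and `K′` after `I` both contain `hi I`. By monotonicity one of them starts
  -- to the left of `I`; since it reaches `hi I`, it contains `I`, against non-nesting.
  hi-boundary : ∀ {I} → I ∈ S → Boundary I (hi I)
  hi-boundary {I} I∈S with within I∈S
  ... | lo≤hi , _ , hi∈L with source∈wires⁺ L S hi∈L I∈S (lo≤hi , ℤ.≤-refl) | sink∈wires⁺ L S hi∈L I∈S (lo≤hi , ℤ.≤-refl)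
  ... | inj₁ p | _      = inj₁ p
  ... | inj₂ _ | inj₁ q = inj₂ q
  ... | inj₂ (K , b , K∋) | inj₂ (K′ , b′ , K′∋)
      with Zig.monotone zig b b′ (common⇒Meet K∋ (lo≤hi , ℤ.≤-refl)) (common⇒Meet (lo≤hi , ℤ.≤-refl) K′∋)
  ... | inj₁ (l , _) = ⊥-elim (proj₂ (Zig.nonNesting zig b) (ℤ.<⇒≤ l , proj₂ K∋))
  ... | inj₂ (_ , l) = ⊥-elim (proj₁ (Zig.nonNesting zig b′) (ℤ.<⇒≤ l , proj₂ K′∋))

-- For meeting intervals of a zig-zag sequence with wires E, this says that I occurs before J.
Precedes : List (Edge Interval) → Interval → Interval → Set
Precedes E I J = (lo I < lo J × (source (lo J) , inner J) ∉ E) ⊎ (lo J < lo I × (source (lo I) , inner I) ∈ E)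

Precedes-asym : ∀ {E I J} → Precedes E I J → Precedes E J I → ⊥
Precedes-asym (inj₁ (l , _)) (inj₁ (l′ , _)) = ℤ.<-asym l l′
Precedes-asym (inj₁ (_ , p)) (inj₂ (_ , q))  = p q
Precedes-asym (inj₂ (_ , p)) (inj₁ (_ , q))  = q p
Precedes-asym (inj₂ (l , _)) (inj₂ (l′ , _)) = ℤ.<-asym l l′

Precedes-↭ : ∀ {E E′ I J} → E ↭ E′ → Precedes E I J → Precedes E′ I J
Precedes-↭ p (inj₁ (l , q)) = inj₁ (l , q ∘ ∈-resp-↭ (↭-sym p))
Precedes-↭ p (inj₂ (l , q)) = inj₂ (l , ∈-resp-↭ p q)

-- If `J` starts further right, then `I` contains `lo J` and comes first on that wire, so `J` is not
-- joined to the source. If `I` starts further right, an interval `K` ahead of `I` on the wire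
-- `lo I` would make `K`, `I`, `J` rise and then fall. Equal left endpoints would force nesting.
Before⇒Precedes : ∀ {L S} → Zig S → Within L S → ∀ {I J} → Before I J S → Meet I J → Precedes (wires L S) I J
Before⇒Precedes {L} {S} zig within {I} {J} b meet with ℤ.<-cmp (lo I) (lo J)
... | tri< l _ _ = inj₁ (l , λ p → through-head zig (proj₂ (source∈wires⁻ L S p)) b
        (ℤ.<⇒≤ l , proj₂ meet) (source∈wires⇒∋ L S p))
... | tri≈ _ eq _ = ⊥-elim ([ proj₁ (Zig.nonNesting zig b) ∘ (λ h → ℤ.≤-reflexive (sym eq) , h)
                            , proj₂ (Zig.nonNesting zig b) ∘ (λ h → ℤ.≤-reflexive eq , h) ]′ (ℤ.≤-total (hi I) (hi J)))
... | tri> _ _ l with within (Before-∈ˡ b)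
...   | lo≤hi , lo∈L , _ with source∈wires⁺ L S lo∈L (Before-∈ˡ b) (ℤ.≤-refl , lo≤hi)
...   | inj₁ p = inj₂ (l , p)
...   | inj₂ (K , b′ , K∋) with Zig.monotone zig b′ b (common⇒Meet K∋ (ℤ.≤-refl , lo≤hi)) meet
...     | inj₁ (_ , l′) = ⊥-elim (ℤ.<-asym l l′)
...     | inj₂ (l′ , _) = contradiction (proj₁ K∋) (ℤ.<⇒≱ l′)

-- Intervals on one wire meet pairwise, so `Precedes`, which depends on the edges alone, governs
-- their order in both sequences.
wires-determine : ∀ {L S S′} → Zig S → Zig S′ → Within L S → Within L S′ →
  SameMembers S S′ → wires L S ↭ wires L S′ → ∀ i → through i S ≡ through i S′
wires-determine {L} {S} {S′} zig zig′ within within′ (f , g) p i =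
  ordered-unique Precedes-asym
    (λ b → ordered zig within b)
    (λ b → Precedes-↭ (↭-sym p) (ordered zig′ within′ b))
    ((λ q → restrict f q) , (λ q → restrict g q))
  where
  ordered : ∀ {S} → Zig S → Within L S → ∀ {I J} → Before I J (through i S) → Precedes (wires L S) I J
  ordered {S} zig within b with Before-filter⁻ (∋? i) S b
  ... | b′ , I∋ , J∋ = Before⇒Precedes zig within b′ (common⇒Meet I∋ J∋)
  restrict : ∀ {S S′} → (∀ {I} → I ∈ S → I ∈ S′) → ∀ {I} → I ∈ through i S → I ∈ through i S′
  restrict {S} f q with ∈-filter⁻ (∋? i) {xs = S} q
  ... | I∈ , I∋ = ∈-filter⁺ (∋? i) (f I∈) I∋

module _ {L N N′ S S′} (zig : Zig S) (within : Within L S) (R : Realizes L N S) (R′ : Realizes L N′ S′)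
         (h : Fin (nInt N) → Fin (nInt N′)) (preserve : ∀ {e} → e ∈ edges N → mapE h e ∈ edges N′) where

  -- Labels of sources and sinks are fixed by `mapE h`, so a vertex joined to a boundary vertex `i`
  -- goes to another one joined to it, whose interval contains `i`. Only one direction of a
  -- correspondence is assumed, so that the result applies to an isomorphism and to its inverse.
  boundary-∋ : ∀ k {i} → Boundary zig within (name R k) i → name R′ (h k) ∋ i
  boundary-∋ k (inj₁ p) with ∈-map⁻ _ (∈-resp-↭ (↭-sym (edges-↭ R)) p)
  ... | (src i , int l) , e∈ , eq with name-injective R (inner-injective (cong proj₂ eq)) | cong proj₁ eq
    where
    inner-injective : ∀ {X : Set} {x y : X} → inner x ≡ inner y → x ≡ y
    inner-injective ≡.refl = ≡.refl
  ...   | ≡.refl | ≡.refl = source∈wires⇒∋ L S′ (∈-resp-↭ (edges-↭ R′) (∈-map⁺ _ (preserve e∈)))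
  boundary-∋ k (inj₂ p) with ∈-map⁻ _ (∈-resp-↭ (↭-sym (edges-↭ R)) p)
  ... | (int l , snk i) , e∈ , eq with name-injective R (inner-injective (cong proj₁ eq)) | cong proj₂ eq
    where
    inner-injective : ∀ {X : Set} {x y : X} → inner x ≡ inner y → x ≡ y
    inner-injective ≡.refl = ≡.refl
  ...   | ≡.refl | ≡.refl = sink∈wires⇒∋ L S′ (∈-resp-↭ (edges-↭ R′) (∈-map⁺ _ (preserve e∈)))

  name-Nested : ∀ k → Nested (name R k) (name R′ (h k))
  name-Nested k = proj₁ (boundary-∋ k (lo-boundary zig within (name-∈ R k)))
                , proj₂ (boundary-∋ k (hi-boundary zig within (name-∈ R k)))

-- Containment of names in both directions makes corresponding vertices carry the same interval. The
-- named edge lists then agree, and `wires-determine` applies.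
≅⇒through≡ : ∀ {L N N′ S S′} → Zig S → Zig S′ → Within L S → Within L S′ →
  Realizes L N S → Realizes L N′ S′ → N ≅ N′ → ∀ i → through i S ≡ through i S′
≅⇒through≡ {L} {N} {N′} {S} {S′} zig zig′ within within′ R R′ (σ , p) =
  wires-determine zig zig′ within within′ (S⊆S′ , S′⊆S)
    (trans (↭-sym (edges-↭ R))
    (trans (↭-reflexive (≡.trans (map-cong (λ e → sym (labelE-mapE same-name e)) (edges N)) (map-∘ (edges N))))
    (trans (map⁺ _ p) (edges-↭ R′))))
  where
  open Inverse σ using (to; from; strictlyInverseˡ; strictlyInverseʳ)
  mapV-from-to : ∀ v → mapV from (mapV to v) ≡ v
  mapV-from-to (src i) = ≡.refl
  mapV-from-to (snk i) = ≡.refl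
  mapV-from-to (int k) = cong int (strictlyInverseʳ k)
  forth : ∀ {e} → e ∈ edges N → mapE to e ∈ edges N′
  forth e∈ = ∈-resp-↭ p (∈-map⁺ _ e∈)
  back′ : ∀ {e} → e ∈ edges N′ → mapE from e ∈ edges N
  back′ e∈ with ∈-map⁻ _ (∈-resp-↭ (↭-sym p) e∈)
  ... | (u , v) , e′∈ , ≡.refl = subst (_∈ edges N) (sym (cong₂ _,_ (mapV-from-to u) (mapV-from-to v))) e′∈
  same-name : ∀ k → name R′ (to k) ≡ name R k
  same-name k with name-Nested zig within R R′ to forth k | name-Nested zig′ within′ R′ R from back′ (to k)
  ... | a , b | c , d rewrite strictlyInverseʳ k = cong₂ _,_ (ℤ.≤-antisym a c) (ℤ.≤-antisym d b)
  S⊆S′ : ∀ {I} → I ∈ S → I ∈ S′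
  S⊆S′ I∈ with vertex R I∈
  ... | k , ≡.refl = subst (_∈ S′) (same-name k) (name-∈ R′ (to k))
  S′⊆S : ∀ {I} → I ∈ S′ → I ∈ S
  S′⊆S I∈ with vertex R′ I∈
  ... | k , ≡.refl = subst (_∈ S) (≡.trans (sym (same-name (from k))) (cong (name R′) (strictlyInverseˡ k))) (name-∈ R (from k))

-- From positions in a list to order of occurrence

module _ {A : Set} where

  lookup-Before : (xs : List A) {i j : Fin (length xs)} → i Fin.< j → Before (lookup xs i) (lookup xs j) xs
  lookup-Before (x ∷ xs) {zero}  {suc j} _       = here (∈-lookup j)
  lookup-Before (x ∷ xs) {suc i} {suc j} (s≤s l) = there (lookup-Before xs l)

  Before-lookup : ∀ {x y : A} {xs} → Before x y xs →
    ∃₂ λ i j → i Fin.< j × lookup xs i ≡ x × lookup xs j ≡ y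
  Before-lookup (here p)  = zero , suc (Any.index p) , s≤s z≤n , ≡.refl , sym (Any.lookup-index p)
  Before-lookup (there b) with Before-lookup b
  ... | i , j , l , eq , eq′ = suc i , suc j , s≤s l , eq , eq′

  Unique⇐Before : ∀ {xs : List A} → (∀ {x} → ¬ Before x x xs) → Unique xs
  Unique⇐Before {[]}     _    = []
  Unique⇐Before {x ∷ xs} irr = All.tabulate (λ { p ≡.refl → irr (here p) }) ∷ Unique⇐Before (irr ∘ there)

-- The map `f` is the identity for lists without repetition, and `profile` for lists without
-- repeated profiles.
lookup-injective-on : {A B : Set} (f : A → B) {xs : List A} → AllPairs (λ x y → f x ≢ f y) xs →
  ∀ i j → f (lookup xs i) ≡ f (lookup xs j) → i ≡ j
lookup-injective-on f {x ∷ xs} (_ ∷ _) zero    zero    _  = ≡.refl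
lookup-injective-on f {x ∷ xs} (p ∷ _) zero    (suc j) eq = ⊥-elim (All.lookup p (∈-lookup j) eq)
lookup-injective-on f {x ∷ xs} (p ∷ _) (suc i) zero    eq = ⊥-elim (All.lookup p (∈-lookup i) (sym eq))
lookup-injective-on f {x ∷ xs} (_ ∷ u) (suc i) (suc j) eq = cong suc (lookup-injective-on f u i j eq)

NonNesting : List Interval → Set
NonNesting S = ∀ {I J} → Before I J S → ¬ Nested I J × ¬ Nested J I

DistinctNonNesting⇒NonNesting : ∀ {xs} → DistinctNonNesting xs → NonNesting xs
DistinctNonNesting⇒NonNesting (_ , f) b with Before-lookup b
... | i , j , l , ≡.refl , ≡.refl = f i j (Fin.<⇒≢ l) , f j i (Fin.<⇒≢ l ∘ sym)

NonNesting⇒DistinctNonNesting : ∀ {xs} → NonNesting xs → DistinctNonNesting xs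
NonNesting⇒DistinctNonNesting {xs} nn =
  Unique⇐Before (λ b → proj₁ (nn b) (ℤ.≤-refl , ℤ.≤-refl)) , separate
  where
  separate : ∀ i j → i ≢ j → ¬ Nested (lookup xs i) (lookup xs j)
  separate i j i≢j with Fin.<-cmp i j
  ... | tri< l _ _  = proj₁ (nn (lookup-Before xs l))
  ... | tri≈ _ eq _ = contradiction eq i≢j
  ... | tri> _ _ l  = proj₂ (nn (lookup-Before xs l))

ZigZag⇒Zig : ∀ {xs} → ZigZag xs → Zig xs
ZigZag⇒Zig {xs} (distinct , mono) = record
  { nonNesting = DistinctNonNesting⇒NonNesting distinct
  ; monotone   = monotone′
  }
  where
  monotone′ : ∀ {I J K} → Before I J xs → Before J K xs → Meet I J → Meet J K →
    (lo I < lo J × lo J < lo K) ⊎ (lo J < lo I × lo K < lo J)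
  monotone′ b c with Before-lookup b | Before-lookup c
  ... | i , j , l , ≡.refl , ≡.refl | j′ , k , l′ , eq , ≡.refl
    -- The middle interval is located twice, at `j` and at `j′`; distinctness identifies the two
    -- positions.
    with lookup-injective-on (λ I → I) (proj₁ distinct) j′ j eq
  ... | ≡.refl = mono i j k l l′

Zig⇒ZigZag : ∀ {xs} → Zig xs → ZigZag xs
Zig⇒ZigZag {xs} zig = NonNesting⇒DistinctNonNesting (Zig.nonNesting zig) ,
  λ i j k l l′ → Zig.monotone zig (lookup-Before xs l) (lookup-Before xs l′)

-- Abstract intervals and the encoding common to both types

-- (a , b) stands for the nontrivial interval [a , b + 1] of {0, …, n}.
U : Set
U = ℕ × ℕ

-- Because the right endpoint is `b + 1`, `a ≤ b` expresses nontriviality and `b < n` containment in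
-- {0, ..., n}.
Valid : ℕ → U → Set
Valid n (a , b) = a ℕ.≤ b × b ℕ.< n

Nestedᵁ Meetᵁ _<ᵁ_ : U → U → Set
Nestedᵁ (a , b) (c , d) = c ℕ.≤ a × b ℕ.≤ d
Meetᵁ (a , b) (c , d) = a ℕ.≤ suc d × c ℕ.≤ suc b
u <ᵁ v = proj₁ u ℕ.< proj₁ v

_∋ᵁ_ : U → ℕ → Set
(a , b) ∋ᵁ i = a ℕ.≤ i × i ℕ.≤ suc b

∋ᵁ? : ∀ i → Decidable (_∋ᵁ i)
∋ᵁ? i (a , b) = (a ℕ.≤? i) ×-dec (i ℕ.≤? suc b)

throughᵁ : ℕ → List U → List U
throughᵁ i = filter (∋ᵁ? i)

NonNestingᵁ Descendingᵁ : List U → Set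
NonNestingᵁ us = ∀ {u v} → Before u v us → ¬ Nestedᵁ u v × ¬ Nestedᵁ v u
Descendingᵁ us = ∀ {u v} → Before u v us → Meetᵁ u v → v <ᵁ u

record Zigᵁ (us : List U) : Set where
  field
    nonNesting : NonNestingᵁ us
    monotone   : ∀ {u v w} → Before u v us → Before v w us → Meetᵁ u v → Meetᵁ v w →
                 (u <ᵁ v × v <ᵁ w) ⊎ (v <ᵁ u × w <ᵁ v)

Descendingᵁ⇒Zigᵁ : ∀ {us} → NonNestingᵁ us → Descendingᵁ us → Zigᵁ us
Descendingᵁ⇒Zigᵁ nn desc = record
  { nonNesting = nn
  ; monotone   = λ b c m m′ → inj₂ (desc b m , desc c m′)
  }

Nestedᵁ-antisym : ∀ {u v} → Nestedᵁ u v → Nestedᵁ v u → u ≡ v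
Nestedᵁ-antisym (p , q) (r , s) = cong₂ _,_ (ℕ.≤-antisym r p) (ℕ.≤-antisym q s)

-- The restrictions to the labels 0, ..., n: the complete invariant by which networks of both types
-- are compared.
profile : ℕ → List U → List (List U)
profile n us = map (λ i → throughᵁ i us) (upTo (suc n))

map-≡⁻ : {A B : Set} {f g : A → B} {xs : List A} → map f xs ≡ map g xs → ∀ {x} → x ∈ xs → f x ≡ g x
map-≡⁻ {xs = x ∷ xs} eq (here ≡.refl) = ∷-injectiveˡ eq
map-≡⁻ {xs = x ∷ xs} eq (there p)     = map-≡⁻ (∷-injectiveʳ eq) p

profile⇒through : ∀ {n us vs i} → profile n us ≡ profile n vs → i ℕ.≤ n → throughᵁ i us ≡ throughᵁ i vs
profile⇒through eq i≤n = map-≡⁻ eq (∈-upTo⁺ (s≤s i≤n))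

profile⇒⊆ : ∀ {n us vs} → profile n us ≡ profile n vs → All (Valid n) us → ∀ {u} → u ∈ us → u ∈ vs
profile⇒⊆ {us = us} {vs} eq valid {a , b} u∈ with All.lookup valid u∈
... | a≤b , b<n = proj₁ (∈-filter⁻ (∋ᵁ? a) {xs = vs}
  (subst (_ ∈_) (profile⇒through {us = us} {vs} eq (ℕ.≤-trans a≤b (ℕ.<⇒≤ b<n)))
    (∈-filter⁺ (∋ᵁ? a) u∈ (ℕ.≤-refl , ℕ.m≤n⇒m≤1+n a≤b))))

-- ex u lists the intervals whose stars make up the network of u.
record Realization (n : ℕ) (ex : U → List Interval) : Set where
  field
    ex-Nested   : ∀ {u v I J} → I ∈ ex u → J ∈ ex v → Nested I J → Nestedᵁ u v
    ex-Meet     : ∀ {u v I J} → I ∈ ex u → J ∈ ex v → Meet I J → Meetᵁ u v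
    -- The left endpoint of a mirror image is the negative of a right endpoint. Hence the order of
    -- second coordinates is supplied, and the result may be increasing or decreasing.
    ex-monotone : ∀ {u v w I J K} → I ∈ ex u → J ∈ ex v → K ∈ ex w → Meet I J → Meet J K →
      u <ᵁ v → v <ᵁ w → proj₂ u ℕ.< proj₂ v → proj₂ v ℕ.< proj₂ w →
      (lo I < lo J × lo J < lo K) ⊎ (lo J < lo I × lo K < lo J)
    ex-disjoint : ∀ {u I J} → Before I J (ex u) → ¬ Meet I J
    ex-≤        : ∀ {u I} → Valid n u → I ∈ ex u → lo I ≤ hi I

Before-++ : ∀ {A : Set} {x y : A} xs {ys} → Before x y (xs ++ ys) →
  Before x y xs ⊎ (x ∈ xs × y ∈ ys) ⊎ Before x y ys
Before-++ []       b = inj₂ (inj₂ b)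
Before-++ (x ∷ xs) (here p) with ∈-++⁻ xs p
... | inj₁ q = inj₁ (here q)
... | inj₂ q = inj₂ (inj₁ (here ≡.refl , q))
Before-++ (x ∷ xs) (there b) with Before-++ xs b
... | inj₁ c              = inj₁ (there c)
... | inj₂ (inj₁ (p , q)) = inj₂ (inj₁ (there p , q))
... | inj₂ (inj₂ c)       = inj₂ (inj₂ c)

∈-concatMap-find : ∀ {A B : Set} (f : A → List B) {y} xs → y ∈ concatMap f xs → ∃ λ x → x ∈ xs × y ∈ f x
∈-concatMap-find f xs p = find (∈-concatMap⁻ f {xs = xs} p)

Before-concatMap : ∀ {A B : Set} (f : A → List B) {x y} us → Before x y (concatMap f us) →
  (∃ λ u → u ∈ us × Before x y (f u)) ⊎ ∃₂ λ u v → Before u v us × x ∈ f u × y ∈ f v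
Before-concatMap f (u ∷ us) b with Before-++ (f u) b
... | inj₁ c = inj₁ (u , here ≡.refl , c)
... | inj₂ (inj₁ (p , q)) with ∈-concatMap-find f us q
...   | v , v∈ , q′ = inj₂ (u , v , here v∈ , p , q′)
Before-concatMap f (u ∷ us) b | inj₂ (inj₂ c) with Before-concatMap f us c
... | inj₁ (v , v∈ , d)         = inj₁ (v , there v∈ , d)
... | inj₂ (v , w , d , p , q)  = inj₂ (v , w , there d , p , q)

<⇒<₂ : ∀ {u v} → ¬ Nestedᵁ v u → u <ᵁ v → proj₂ u ℕ.< proj₂ v
<⇒<₂ ¬nested l = ℕ.≰⇒> (λ q → ¬nested (ℕ.<⇒≤ l , q))

Meet-swap : ∀ {I J} → Meet I J → Meet J I
Meet-swap (p , q) = q , p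

module _ {n ex} (R : Realization n ex) where
  open Realization R

  ex-injective : ∀ {u v I} → I ∈ ex u → I ∈ ex v → u ≡ v
  ex-injective p q = Nestedᵁ-antisym (ex-Nested p q (ℤ.≤-refl , ℤ.≤-refl)) (ex-Nested q p (ℤ.≤-refl , ℤ.≤-refl))

  -- Intervals of one `ex u` do not meet, so meeting neighbours come from different entries, and
  -- `ex-injective` makes the two entries found for the middle interval coincide.
  concatMap-Zig : ∀ {us} → All (Valid n) us → Zigᵁ us → Zig (concatMap ex us)
  concatMap-Zig {us} valid zig = record { nonNesting = nn ; monotone = mono }
    where
    open Zigᵁ zig
    nn : NonNesting (concatMap ex us)
    nn b with Before-concatMap ex us b
    ... | inj₁ (u , u∈ , c) =
        (λ (p , q) → ex-disjoint c (ℤ.≤-trans I≤ q , ℤ.≤-trans p I≤)) ,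
        (λ (p , q) → ex-disjoint c (ℤ.≤-trans p J≤ , ℤ.≤-trans J≤ q))
      where
      I≤ = ex-≤ (All.lookup valid u∈) (Before-∈ˡ c)
      J≤ = ex-≤ (All.lookup valid u∈) (Before-∈ʳ c)
    ... | inj₂ (u , v , c , p , q) = proj₁ (nonNesting c) ∘ ex-Nested p q , proj₂ (nonNesting c) ∘ ex-Nested q p
    mono : ∀ {I J K} → Before I J (concatMap ex us) → Before J K (concatMap ex us) → Meet I J → Meet J K →
      (lo I < lo J × lo J < lo K) ⊎ (lo J < lo I × lo K < lo J)
    mono b b′ m m′ with Before-concatMap ex us b | Before-concatMap ex us b′
    ... | inj₁ (_ , _ , c) | _ = contradiction m (ex-disjoint c)
    ... | inj₂ _ | inj₁ (_ , _ , c) = contradiction m′ (ex-disjoint c)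
    ... | inj₂ (u , v , c , p , q) | inj₂ (v′ , w , c′ , q′ , r) with ex-injective q′ q
    ...   | ≡.refl with monotone c c′ (ex-Meet p q m) (ex-Meet q r m′)
    ...     | inj₁ (l , l′) = ex-monotone p q r m m′ l l′
                (<⇒<₂ (proj₂ (nonNesting c)) l) (<⇒<₂ (proj₂ (nonNesting c′)) l′)
    -- A decreasing triple is an increasing one read backwards.
    ...     | inj₂ (l , l′) = Sum.swap (Sum.map (λ (x , y) → y , x) (λ (x , y) → y , x)
                (ex-monotone r q p (Meet-swap m′) (Meet-swap m) l′ l
                  (<⇒<₂ (proj₁ (nonNesting c′)) l′) (<⇒<₂ (proj₁ (nonNesting c)) l)))

  -- The network label `i` displays the abstract label `k`: it is `k + 1` in type A, and `k` or `-k`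
  -- in type BC.
  through-concatMap : ∀ i k (g : U → Interval) us →
    (∀ {u} → u ∈ us → u ∋ᵁ k → through i (ex u) ≡ g u ∷ []) →
    (∀ {u} → u ∈ us → ¬ u ∋ᵁ k → through i (ex u) ≡ []) →
    through i (concatMap ex us) ≡ map g (throughᵁ k us)
  through-concatMap i k g []       _   _  = ≡.refl
  through-concatMap i k g (u ∷ us) yea nay =
    ≡.trans (filter-++ (∋? i) (ex u) (concatMap ex us)) (step (∋ᵁ? k u))
    where
    rest = through-concatMap i k g us (yea ∘ there) (nay ∘ there)
    step : Dec (u ∋ᵁ k) → through i (ex u) ++ through i (concatMap ex us) ≡ map g (throughᵁ k (u ∷ us))
    step (yes p) = ≡.trans (cong₂ _++_ (yea (here ≡.refl) p) rest) (cong (map g) (sym (filter-accept (∋ᵁ? k) p)))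
    step (no ¬p) = ≡.trans (cong₂ _++_ (nay (here ≡.refl) ¬p) rest) (cong (map g) (sym (filter-reject (∋ᵁ? k) ¬p)))

-- Label sets

i<suc[i] : ∀ i → i < ℤ.suc i
i<suc[i] i = ℤ.suc[i]≤j⇒i<j ℤ.≤-refl

i<suc[j]⇒i≤j : ∀ {i j} → i < ℤ.suc j → i ≤ j
i<suc[j]⇒i≤j {i} {j} l = ℤ.≤-trans (ℤ.i<j⇒i≤pred[j] l) (ℤ.≤-reflexive (ℤ.pred-suc j))

range-∈⁻ : ∀ {i} h k → i ∈ range h k → h ≤ i × i < h ℤ.+ + k
range-∈⁻ h (suc k) (here ≡.refl) =
  ℤ.≤-refl , ℤ.≤-<-trans (ℤ.≤-reflexive (sym (ℤ.+-identityʳ h))) (ℤ.+-monoʳ-< h (+<+ (s≤s z≤n)))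
range-∈⁻ h (suc k) (there p) with range-∈⁻ (h ℤ.+ + 1) k p
... | q , r = ℤ.≤-trans (ℤ.i≤i+j h (+ 1)) q , ℤ.<-≤-trans r (ℤ.≤-reflexive (ℤ.+-assoc h (+ 1) (+ k)))

range-∈⁺ : ∀ {i} h k → h ≤ i → i < h ℤ.+ + k → i ∈ range h k
range-∈⁺ h zero    p q = contradiction (ℤ.≤-<-trans p q) (ℤ.<-irrefl (sym (ℤ.+-identityʳ h)))
range-∈⁺ {i} h (suc k) p q with h ≟ i
... | yes ≡.refl = here ≡.refl
... | no  h≢i    = there (range-∈⁺ (h ℤ.+ + 1) k
        (ℤ.≤-trans (ℤ.≤-reflexive (ℤ.+-comm h (+ 1))) (ℤ.i<j⇒suc[i]≤j (ℤ.≤∧≢⇒< p h≢i)))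
        (ℤ.<-≤-trans q (ℤ.≤-reflexive (sym (ℤ.+-assoc h (+ 1) (+ k))))))

range-unique : ∀ h k → Unique (range h k)
range-unique h zero    = []
range-unique h (suc k) = All.tabulate (λ { p ≡.refl → ℤ.<⇒≱ (i<suc[i] h)
    (ℤ.≤-trans (ℤ.≤-reflexive (ℤ.+-comm (+ 1) h)) (proj₁ (range-∈⁻ (h ℤ.+ + 1) k p))) })
  ∷ range-unique (h ℤ.+ + 1) k

labels-unique : ∀ h l → Unique (labels h l)
labels-unique h l = Unique.filter⁺ (λ i → nonzero i Bool.≟ true) (range-unique h (suc ℤ.∣ l ℤ.- h ∣))

module _ {h l : ℤ} (h≤l : h ≤ l) where

  private
    end : h ℤ.+ + suc ℤ.∣ l ℤ.- h ∣ ≡ ℤ.suc l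
    end = ≡.trans (cong (λ d → h ℤ.+ ℤ.suc d) (ℤ.0≤i⇒+∣i∣≡i (ℤ.i≤j⇒0≤j-i h≤l)))
      (≡.trans (sym (ℤ.+-assoc h (+ 1) (l ℤ.- h)))
      (≡.trans (cong (ℤ._+ (l ℤ.- h)) (ℤ.+-comm h (+ 1)))
      (≡.trans (ℤ.+-assoc (+ 1) h (l ℤ.- h)) (cong ℤ.suc
        (≡.trans (cong (λ x → h ℤ.+ x) (ℤ.+-comm l (ℤ.- h)))
        (≡.trans (sym (ℤ.+-assoc h (ℤ.- h) l)) (≡.trans (cong (ℤ._+ l) (ℤ.+-inverseʳ h)) (ℤ.+-identityˡ l))))))))

  labels-∈⁻ : ∀ {i} → i ∈ labels h l → h ≤ i × i ≤ l × nonzero i ≡ true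
  labels-∈⁻ p with ∈-filter⁻ (λ i → nonzero i Bool.≟ true) {xs = range h _} p
  ... | q , nz with range-∈⁻ h _ q
  ...   | r , s = r , i<suc[j]⇒i≤j (ℤ.<-≤-trans s (ℤ.≤-reflexive end)) , nz

  labels-∈⁺ : ∀ {i} → h ≤ i → i ≤ l → nonzero i ≡ true → i ∈ labels h l
  labels-∈⁺ p q nz = ∈-filter⁺ (λ i → nonzero i Bool.≟ true)
    (range-∈⁺ h _ p (ℤ.<-≤-trans (ℤ.≤-<-trans q (i<suc[i] _)) (ℤ.≤-reflexive (sym end)))) nz

-- What types A and BC have in common

record Kind (n : ℕ) : Set₁ where
  field
    L       : List ℤ
    unique  : Unique L
    cell    : Interval → Network
    enc     : U → Interval
    ex      : U → List Interval
    realization  : Realization n ex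
    enc∈ex       : ∀ u → enc u ∈ ex u
    enc-Nested   : ∀ {u v} → Nestedᵁ u v → Nested (enc u) (enc v)
    enc-Meet     : ∀ {u v} → Meetᵁ u v → Meet (enc u) (enc v)
    enc-<        : ∀ {u v} → u <ᵁ v → lo (enc u) < lo (enc v)
    cell-realizes : ∀ {u} → Valid n u → Realizes L (cell (enc u)) (ex u)
    ex-within    : ∀ {u} → Valid n u → Within L (ex u)
    -- Every abstract label is recovered, even 0, which is not a label in type BC. The converse
    -- below starts from the labels up to `n` only, which is what a profile records.
    through⇒throughᵁ : ∀ {us vs} → All (Valid n) us → All (Valid n) vs →
      (∀ i → through i (concatMap ex us) ≡ through i (concatMap ex vs)) → ∀ k → throughᵁ k us ≡ throughᵁ k vs
    throughᵁ⇒through : ∀ {us vs} → All (Valid n) us → All (Valid n) vs →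
      (∀ {k} → k ℕ.≤ n → throughᵁ k us ≡ throughᵁ k vs) →
      ∀ {i} → i ∈ L → through i (concatMap ex us) ≡ through i (concatMap ex vs)

  open Realization realization

  network : List Interval → Network
  network []       = trivial L
  network (I ∷ xs) = cell I • network xs

  data Decodes : List Interval → List U → Set where
    []   : Decodes [] []
    skip : ∀ {I xs us} → Realizes L (cell I) [] → Decodes xs us → Decodes (I ∷ xs) us
    keep : ∀ {u xs us} → Valid n u → Decodes xs us → Decodes (enc u ∷ xs) (u ∷ us)

  map-Decodes : ∀ {us} → All (Valid n) us → Decodes (map enc us) us
  map-Decodes []         = []
  map-Decodes (px ∷ pxs) = keep px (map-Decodes pxs)

  Decodes-Valid : ∀ {xs us} → Decodes xs us → All (Valid n) us
  Decodes-Valid []         = []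
  Decodes-Valid (skip _ d) = Decodes-Valid d
  Decodes-Valid (keep v d) = v ∷ Decodes-Valid d

  Decodes-∈ : ∀ {xs us u} → Decodes xs us → u ∈ us → enc u ∈ xs
  Decodes-∈ (skip _ d) p             = there (Decodes-∈ d p)
  Decodes-∈ (keep _ d) (here ≡.refl) = here ≡.refl
  Decodes-∈ (keep _ d) (there p)     = there (Decodes-∈ d p)

  Decodes-Before : ∀ {xs us u v} → Decodes xs us → Before u v us → Before (enc u) (enc v) xs
  Decodes-Before (skip _ d) b         = there (Decodes-Before d b)
  Decodes-Before (keep _ d) (here p)  = here (Decodes-∈ d p)
  Decodes-Before (keep _ d) (there b) = there (Decodes-Before d b)

  -- Trichotomy reverses `enc-<`; equal left endpoints are excluded by non-nesting.
  enc-<⁻ : ∀ {u v} → ¬ Nestedᵁ u v → ¬ Nestedᵁ v u → lo (enc u) < lo (enc v) → u <ᵁ v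
  enc-<⁻ {a , b} {c , d} ¬uv ¬vu l with ℕ.<-cmp a c
  ... | tri< a<c _ _ = a<c
  ... | tri> _ _ c<a = ⊥-elim (ℤ.<-asym l (enc-< c<a))
  ... | tri≈ _ ≡.refl _ = ⊥-elim ([ (λ p → ¬uv (ℕ.≤-refl , p)) , (λ p → ¬vu (ℕ.≤-refl , p)) ]′ (ℕ.≤-total b d))

  module _ {xs us} (d : Decodes xs us) where

    Decodes-NonNesting : NonNesting xs → NonNestingᵁ us
    Decodes-NonNesting nn b with nn (Decodes-Before d b)
    ... | p , q = p ∘ enc-Nested , q ∘ enc-Nested

    Decodes-Zig : Zig xs → Zigᵁ us
    Decodes-Zig zig = record { nonNesting = nn ; monotone = mono }
      where
      nn = Decodes-NonNesting (Zig.nonNesting zig)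
      mono : ∀ {u v w} → Before u v us → Before v w us → Meetᵁ u v → Meetᵁ v w →
        (u <ᵁ v × v <ᵁ w) ⊎ (v <ᵁ u × w <ᵁ v)
      mono b c m m′ with Zig.monotone zig (Decodes-Before d b) (Decodes-Before d c) (enc-Meet m) (enc-Meet m′)
                       | nn b | nn c
      ... | inj₁ (l , l′) | p , q | r , s = inj₁ (enc-<⁻ p q l , enc-<⁻ r s l′)
      ... | inj₂ (l , l′) | p , q | r , s = inj₂ (enc-<⁻ q p l , enc-<⁻ s r l′)

    Decodes-Descending : Descending xs → Descendingᵁ us
    Decodes-Descending (distinct , desc) b m
      with Decodes-NonNesting (DistinctNonNesting⇒NonNesting distinct) b | Before-lookup (Decodes-Before d b)
    ... | p , q | i , j , l , eq , eq′ = enc-<⁻ q p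
      (≡.subst₂ (λ I J → lo J < lo I) eq eq′ (desc i j l (≡.subst₂ Meet (sym eq) (sym eq′) (enc-Meet m))))

    Decodes-realizes : NonNestingᵁ us → Realizes L (network xs) (concatMap ex us)
    Decodes-realizes = go d
      where
      go : ∀ {xs us} → Decodes xs us → NonNestingᵁ us → Realizes L (network xs) (concatMap ex us)
      go []         nn = trivial-realizes L
      go (skip r d) nn = •-realizes unique (λ ()) r (go d nn)
      go (keep {u} {us = us} v d) nn = •-realizes unique disjoint (cell-realizes v) (go d (nn ∘ there))
        where
        disjoint : ∀ {I} → I ∈ ex u → I ∈ concatMap ex us → ⊥
        disjoint p q with ∈-concatMap-find ex us q
        ... | w , w∈ , q′ with ex-injective realization p q′
        ...   | ≡.refl = proj₁ (nn (here w∈)) (ℕ.≤-refl , ℕ.≤-refl)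

  concatMap-within : ∀ {us} → All (Valid n) us → Within L (concatMap ex us)
  concatMap-within {us} valid p with ∈-concatMap-find ex us p
  ... | u , u∈ , q = ex-within (All.lookup valid u∈) q

  -- The zig-zag hypothesis passes to the sequence of all stars, which is then read off from the
  -- network.
  ≅⇒profile : ∀ {xs ys us vs} → Decodes xs us → Decodes ys vs → Zigᵁ us → Zigᵁ vs →
    network xs ≅ network ys → profile n us ≡ profile n vs
  ≅⇒profile {us = us} {vs} d e zig zig′ iso = map-cong
    (through⇒throughᵁ {us} {vs} (Decodes-Valid d) (Decodes-Valid e)
      (≅⇒through≡ (concatMap-Zig realization (Decodes-Valid d) zig) (concatMap-Zig realization (Decodes-Valid e) zig′)
        (concatMap-within (Decodes-Valid d)) (concatMap-within (Decodes-Valid e))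
        (Decodes-realizes d (Zigᵁ.nonNesting zig)) (Decodes-realizes e (Zigᵁ.nonNesting zig′)) iso))
    (upTo (suc n))

  -- Each abstract interval appears in the profile at its own left endpoint, so equal profiles give
  -- the same stars as well as the same order along every wire.
  profile⇒≅ : ∀ {xs ys us vs} → Decodes xs us → Decodes ys vs → NonNestingᵁ us → NonNestingᵁ vs →
    profile n us ≡ profile n vs → network xs ≅ network ys
  profile⇒≅ {us = us} {vs} d e nn nn′ eq = realizes-≅ (Decodes-realizes d nn) (Decodes-realizes e nn′)
    ( concatMap-⊆ (profile⇒⊆ {us = us} {vs} eq (Decodes-Valid d))
    , concatMap-⊆ (profile⇒⊆ {us = vs} {us} (sym eq) (Decodes-Valid e)))
    (↭-reflexive (concatMap-cong-local (λ {i} i∈ → cong (wire i)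
      (throughᵁ⇒through {us} {vs} (Decodes-Valid d) (Decodes-Valid e) (profile⇒through {us = us} {vs} eq) i∈))))
    where
    concatMap-⊆ : ∀ {us vs} → (∀ {u} → u ∈ us → u ∈ vs) → ∀ {I} → I ∈ concatMap ex us → I ∈ concatMap ex vs
    concatMap-⊆ {us} {vs} f p with ∈-concatMap-find ex us p
    ... | u , u∈ , q = ∈-concatMap⁺ ex (Any.map (λ { ≡.refl → q }) (f u∈))

  -- Keeping only `enc u` from each `ex u` is again a realization, so `concatMap-Zig` also shows
  -- that the encoded sequence itself is zig-zag.
  enc-Realization : Realization n (λ u → enc u ∷ [])
  enc-Realization = record
    { ex-Nested   = λ { {u} {v} (here ≡.refl) (here ≡.refl) → ex-Nested (enc∈ex u) (enc∈ex v) }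
    ; ex-Meet     = λ { {u} {v} (here ≡.refl) (here ≡.refl) → ex-Meet (enc∈ex u) (enc∈ex v) }
    ; ex-monotone = λ { {u} {v} {w} (here ≡.refl) (here ≡.refl) (here ≡.refl) →
                          ex-monotone (enc∈ex u) (enc∈ex v) (enc∈ex w) }
    ; ex-disjoint = λ { (here ()) ; (there ()) }
    ; ex-≤        = λ { {u} v (here ≡.refl) → ex-≤ v (enc∈ex u) }
    }

  map-ZigZag : ∀ {us} → All (Valid n) us → Zigᵁ us → ZigZag (map enc us)
  map-ZigZag {us} valid zig = Zig⇒ZigZag (subst Zig (concatMap-[-] enc us) (concatMap-Zig enc-Realization valid zig))

  map-Descending : ∀ {us} → All (Valid n) us → NonNestingᵁ us → Descendingᵁ us → Descending (map enc us)
  map-Descending {us} valid nn desc = proj₁ (map-ZigZag valid (Descendingᵁ⇒Zigᵁ nn desc)) , λ i j l → step (lookup-Before (map enc us) l)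
    where
    step : ∀ {I J} → Before I J (map enc us) → Meet I J → lo J < lo I
    step b m with Before-concatMap (λ u → enc u ∷ []) us (subst (Before _ _) (sym (concatMap-[-] enc us)) b)
    ... | inj₁ (_ , _ , here ())
    ... | inj₁ (_ , _ , there ())
    ... | inj₂ (u , v , c , here ≡.refl , here ≡.refl) = enc-< (desc c (ex-Meet (enc∈ex u) (enc∈ex v) m))

through-accept : ∀ i I S → I ∋ i → through i (I ∷ S) ≡ I ∷ through i S
through-accept i I S = filter-accept (∋? i) {I} {S}

through-reject : ∀ i I S → ¬ I ∋ i → through i (I ∷ S) ≡ through i S
through-reject i I S = filter-reject (∋? i) {I} {S}

-- Type A

labelsA : ℕ → List ℤ
labelsA n = labels (+ 1) (+ suc n)

labelsA-∈⁻ : ∀ n {i} → i ∈ labelsA n → ∃ λ k → k ℕ.≤ n × i ≡ + suc k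
labelsA-∈⁻ n p with labels-∈⁻ {+ 1} {+ suc n} (+≤+ (s≤s z≤n)) p
... | +≤+ (s≤s z≤n) , +≤+ (s≤s q) , _ = _ , q , ≡.refl

labelsA-∈⁺ : ∀ n {k} → k ℕ.≤ n → + suc k ∈ labelsA n
labelsA-∈⁺ n k≤n = labels-∈⁺ {+ 1} {+ suc n} (+≤+ (s≤s z≤n)) (+≤+ (s≤s z≤n)) (+≤+ (s≤s k≤n)) ≡.refl

encA : U → Interval
encA (a , b) = + suc a , + suc (suc b)

exA : U → List Interval
exA u = encA u ∷ []

realizationA : ∀ n → Realization n exA
realizationA n = record
  { ex-Nested   = λ { (here ≡.refl) (here ≡.refl) (+≤+ (s≤s p) , +≤+ (s≤s (s≤s q))) → p , q }
  ; ex-Meet     = λ { (here ≡.refl) (here ≡.refl) (+≤+ (s≤s p) , +≤+ (s≤s q)) → p , q }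
  ; ex-monotone = λ { (here ≡.refl) (here ≡.refl) (here ≡.refl) _ _ p q _ _ →
                        inj₁ (+<+ (s≤s p) , +<+ (s≤s q)) }
  ; ex-disjoint = λ { (here ()) ; (there ()) }
  ; ex-≤        = λ { (a≤b , _) (here ≡.refl) → +≤+ (s≤s (ℕ.m≤n⇒m≤1+n a≤b)) }
  }

through-exA : ∀ n k us → through (+ suc k) (concatMap exA us) ≡ map encA (throughᵁ k us)
through-exA n k us = through-concatMap (realizationA n) (+ suc k) k encA us
  (λ {u} _ (p , q) → through-accept (+ suc k) (encA u) [] (+≤+ (s≤s p) , +≤+ (s≤s q)))
  (λ {u} _ ¬p → through-reject (+ suc k) (encA u) [] (λ { (+≤+ (s≤s p) , +≤+ (s≤s q)) → ¬p (p , q) }))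

encA-injective : ∀ {u v} → encA u ≡ encA v → u ≡ v
encA-injective ≡.refl = ≡.refl

kindA : ∀ n → Kind n
kindA n = record
  { L       = labelsA n
  ; unique  = labels-unique (+ 1) (+ suc n)
  ; cell    = λ I → star (labelsA n) (lo I) (hi I)
  ; enc     = encA
  ; ex      = exA
  ; realization = realizationA n
  ; enc∈ex      = λ _ → here ≡.refl
  ; enc-Nested  = λ (p , q) → +≤+ (s≤s p) , +≤+ (s≤s (s≤s q))
  ; enc-Meet    = λ (p , q) → +≤+ (s≤s p) , +≤+ (s≤s q)
  ; enc-<       = λ p → +<+ (s≤s p)
  ; cell-realizes = λ (a≤b , _) → star-realizes (labelsA n) (+<+ (s≤s (s≤s a≤b)))
  ; ex-within   = λ { (a≤b , b<n) (here ≡.refl) →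
      +≤+ (s≤s (ℕ.m≤n⇒m≤1+n a≤b)) , labelsA-∈⁺ n (ℕ.≤-trans a≤b (ℕ.<⇒≤ b<n)) , labelsA-∈⁺ n b<n }
  ; through⇒throughᵁ = λ {us} {vs} _ _ eq k → map-injective encA-injective
      (≡.trans (sym (through-exA n k us)) (≡.trans (eq (+ suc k)) (through-exA n k vs)))
  ; throughᵁ⇒through = to-through
  }
  where
  to-through : ∀ {us vs} → All (Valid n) us → All (Valid n) vs →
    (∀ {k} → k ℕ.≤ n → throughᵁ k us ≡ throughᵁ k vs) →
    ∀ {i} → i ∈ labelsA n → through i (concatMap exA us) ≡ through i (concatMap exA vs)
  to-through {us} {vs} _ _ eq i∈ with labelsA-∈⁻ n i∈
  ... | k , k≤n , ≡.refl = ≡.trans (through-exA n k us)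
    (≡.trans (cong (map encA) (eq k≤n)) (sym (through-exA n k vs)))

networkA≡ : ∀ n xs → Kind.network (kindA n) xs ≡ netA n xs
networkA≡ n []       = ≡.refl
networkA≡ n (I ∷ xs) = cong (star (labelsA n) (lo I) (hi I) •_) (networkA≡ n xs)

decodeA : ∀ n {xs} → All (InA (+ 1) (+ suc n)) xs → ∃ (Kind.Decodes (kindA n) xs)
decodeA n [] = [] , Kind.[]
decodeA n {(c , d) ∷ xs} ((c≤d , c∈ , d∈) ∷ all) with decodeA n all | labelsA-∈⁻ n c∈ | labelsA-∈⁻ n d∈
... | us , dec | k , _ , ≡.refl | l , l≤n , ≡.refl with k ℕ.<? l
...   | no  k≮l = us , Kind.skip (star-realizes-[] (labelsA n) (λ { (+<+ (s≤s q)) → k≮l q })) dec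
...   | yes (s≤s k≤b) = (k , _) ∷ us , Kind.keep (k≤b , l≤n) dec

InA-encA : ∀ n {us} → All (Valid n) us → All (InA (+ 1) (+ suc n)) (map encA us)
InA-encA n [] = []
InA-encA n ((a≤b , b<n) ∷ all) =
  (+≤+ (s≤s (ℕ.m≤n⇒m≤1+n a≤b)) , labelsA-∈⁺ n (ℕ.≤-trans a≤b (ℕ.<⇒≤ b<n)) , labelsA-∈⁺ n b<n) ∷ InA-encA n all

-- Type BC

neg≤pos : ∀ n → ℤ.- + n ≤ + n
neg≤pos zero    = +≤+ z≤n
neg≤pos (suc n) = -≤+

data LabelBC (n : ℕ) : ℤ → Set where
  pos : ∀ {k} → k ℕ.< n → LabelBC n (+ suc k)
  neg : ∀ {k} → k ℕ.< n → LabelBC n -[1+ k ]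

labelsBC-∈⁻ : ∀ n {i} → i ∈ labelsBC n → LabelBC n i
labelsBC-∈⁻ n {i} p with labels-∈⁻ (neg≤pos n) p
labelsBC-∈⁻ n {+ zero}     p | _ , _ , ()
labelsBC-∈⁻ n {+ suc k}    p | _ , +≤+ q , _ = pos q
labelsBC-∈⁻ (suc n) { -[1+ k ]} p | -≤- q , _ , _ = neg (s≤s q)
labelsBC-∈⁻ zero { -[1+ k ]} p | () , _ , _

labelsBC-∈⁺ : ∀ n {i} → LabelBC n i → i ∈ labelsBC n
labelsBC-∈⁺ (suc n) (pos q)       = labels-∈⁺ (neg≤pos (suc n)) -≤+ (+≤+ q) ≡.refl
labelsBC-∈⁺ (suc n) (neg (s≤s q)) = labels-∈⁺ (neg≤pos (suc n)) (-≤- q) -≤+ ≡.refl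

encB mirrorB : U → Interval
encB (zero  , b) = -[1+ b ] , + suc b
encB (suc a , b) = + suc a , + suc b
mirrorB (zero  , b) = -[1+ b ] , + suc b
mirrorB (suc a , b) = -[1+ b ] , -[1+ a ]

-- A symmetric interval is its own mirror image and gives a single star.
exB : U → List Interval
exB (zero  , b) = encB (zero , b) ∷ []
exB (suc a , b) = encB (suc a , b) ∷ mirrorB (suc a , b) ∷ []

data InB : U → Interval → Set where
  mid : ∀ {b}   → InB (zero , b) (-[1+ b ] , + suc b)
  pos : ∀ {a b} → InB (suc a , b) (+ suc a , + suc b)
  neg : ∀ {a b} → InB (suc a , b) (-[1+ b ] , -[1+ a ])

inB : ∀ {u I} → I ∈ exB u → InB u I
inB {zero  , b} (here ≡.refl)         = mid
inB {suc a , b} (here ≡.refl)         = pos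
inB {suc a , b} (there (here ≡.refl)) = neg

InB-Nested : ∀ {u v I J} → InB u I → InB v J → Nested I J → Nestedᵁ u v
InB-Nested mid mid (_ , +≤+ (s≤s q))             = z≤n , q
InB-Nested pos mid (_ , +≤+ (s≤s q))             = z≤n , q
InB-Nested neg mid (-≤- q , _)                   = z≤n , q
InB-Nested pos pos (+≤+ p , +≤+ (s≤s q))         = p , q
InB-Nested neg neg (-≤- q , -≤- p)               = s≤s p , q
InB-Nested mid pos (() , _)
InB-Nested mid neg (_ , ())
InB-Nested pos neg (_ , ())
InB-Nested neg pos (() , _)

InB-Meet : ∀ {u v I J} → InB u I → InB v J → Meet I J → Meetᵁ u v
InB-Meet mid mid _             = z≤n , z≤n
InB-Meet pos mid (+≤+ p , _)   = p , z≤n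
InB-Meet mid pos (_ , +≤+ p)   = z≤n , p
InB-Meet neg mid (_ , -≤- p)   = s≤s p , z≤n
InB-Meet mid neg (-≤- p , _)   = z≤n , s≤s p
InB-Meet pos pos (+≤+ p , +≤+ q) = p , q
InB-Meet neg neg (-≤- p , -≤- q) = s≤s q , s≤s p
InB-Meet pos neg (() , _)
InB-Meet neg pos (_ , ())

-- Only the first interval can be symmetric, since the other two start further right. Meeting keeps
-- the rest on one side of 0: left endpoints increase on the positive side and decrease on the
-- negative side.
InB-monotone : ∀ {u v w I J K} → InB u I → InB v J → InB w K → Meet I J → Meet J K →
  u <ᵁ v → v <ᵁ w → proj₂ u ℕ.< proj₂ v → proj₂ v ℕ.< proj₂ w →
  (lo I < lo J × lo J < lo K) ⊎ (lo J < lo I × lo K < lo J)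
InB-monotone mid pos pos _ _ p q _ _ = inj₁ (-<+ , +<+ q)
InB-monotone pos pos pos _ _ p q _ _ = inj₁ (+<+ p , +<+ q)
InB-monotone mid neg neg _ _ _ _ r s = inj₂ (-<- r , -<- s)
InB-monotone neg neg neg _ _ _ _ r s = inj₂ (-<- r , -<- s)
InB-monotone neg pos _ (_ , ()) _ _ _ _ _
InB-monotone pos neg _ (() , _) _ _ _ _ _
InB-monotone _ pos neg _ (() , _) _ _ _ _
InB-monotone _ neg pos _ (_ , ()) _ _ _ _

realizationB : ∀ n → Realization n exB
realizationB n = record
  { ex-Nested   = λ p q → InB-Nested (inB p) (inB q)
  ; ex-Meet     = λ p q → InB-Meet (inB p) (inB q)
  ; ex-monotone = λ p q r → InB-monotone (inB p) (inB q) (inB r)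
  ; ex-disjoint = λ {u} → disjoint {u}
  ; ex-≤        = λ v p → ordered v (inB p)
  }
  where
  disjoint : ∀ {u I J} → Before I J (exB u) → ¬ Meet I J
  disjoint {suc a , b} (here (here ≡.refl)) (() , _)
  disjoint {suc a , b} (there (here ()))
  disjoint {zero , b} (here ())
  ordered : ∀ {u I} → Valid n u → InB u I → lo I ≤ hi I
  ordered _         mid = -≤+
  ordered (a≤b , _) pos = +≤+ (ℕ.m≤n⇒m≤1+n a≤b)
  ordered (a≤b , _) neg = -≤- (ℕ.<⇒≤ a≤b)

through-pos : ∀ n k us → through (+ suc k) (concatMap exB us) ≡ map encB (throughᵁ (suc k) us)
through-pos n k us = through-concatMap (realizationB n) (+ suc k) (suc k) encB us
  (λ {u} _ → accept u) (λ {u} _ → reject u)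
  where
  accept : ∀ u → u ∋ᵁ suc k → through (+ suc k) (exB u) ≡ encB u ∷ []
  accept u@(zero  , b) (_ , q) = through-accept (+ suc k) (encB u) [] (-≤+ , +≤+ q)
  accept u@(suc a , b) (p , q) = ≡.trans (through-accept (+ suc k) (encB u) (mirrorB u ∷ []) (+≤+ p , +≤+ q))
    (cong (encB u ∷_) (through-reject (+ suc k) (mirrorB u) [] (λ ())))
  reject : ∀ u → ¬ u ∋ᵁ suc k → through (+ suc k) (exB u) ≡ []
  reject u@(zero  , b) ¬p = through-reject (+ suc k) (encB u) [] (λ { (_ , +≤+ q) → ¬p (z≤n , q) })
  reject u@(suc a , b) ¬p = ≡.trans
    (through-reject (+ suc k) (encB u) (mirrorB u ∷ []) (λ { (+≤+ p , +≤+ q) → ¬p (p , q) }))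
    (through-reject (+ suc k) (mirrorB u) [] (λ ()))

through-neg : ∀ n k us → through -[1+ k ] (concatMap exB us) ≡ map mirrorB (throughᵁ (suc k) us)
through-neg n k us = through-concatMap (realizationB n) -[1+ k ] (suc k) mirrorB us
  (λ {u} _ → accept u) (λ {u} _ → reject u)
  where
  accept : ∀ u → u ∋ᵁ suc k → through -[1+ k ] (exB u) ≡ mirrorB u ∷ []
  accept u@(zero  , b) (_ , s≤s q)     = through-accept -[1+ k ] (encB u) [] (-≤- q , -≤+)
  accept u@(suc a , b) (s≤s p , s≤s q) = ≡.trans
    (through-reject -[1+ k ] (encB u) (mirrorB u ∷ []) (λ ()))
    (through-accept -[1+ k ] (mirrorB u) [] (-≤- q , -≤- p))
  reject : ∀ u → ¬ u ∋ᵁ suc k → through -[1+ k ] (exB u) ≡ []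
  reject u@(zero  , b) ¬p = through-reject -[1+ k ] (encB u) [] (λ { (-≤- q , _) → ¬p (z≤n , s≤s q) })
  reject u@(suc a , b) ¬p = ≡.trans
    (through-reject -[1+ k ] (encB u) (mirrorB u ∷ []) (λ ()))
    (through-reject -[1+ k ] (mirrorB u) [] (λ { (-≤- q , -≤- p) → ¬p (s≤s p , s≤s q) }))

encB-injective : ∀ {u v} → encB u ≡ encB v → u ≡ v
encB-injective {zero  , b} {zero  , d} ≡.refl = ≡.refl
encB-injective {suc a , b} {suc c , d} ≡.refl = ≡.refl

-- Every interval containing 0 contains 1.
through-0 : ∀ us → throughᵁ 0 us ≡ throughᵁ 0 (throughᵁ 1 us)
through-0 []                = ≡.refl
through-0 ((zero , b) ∷ us) = cong (_ ∷_) (through-0 us)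
through-0 ((suc a , b) ∷ us) with suc a ℕ.≤ᵇ 1
... | true  = through-0 us
... | false = through-0 us

starBC-realizes : ∀ {n u} → Valid n u → Realizes (labelsBC n) (starBC n (encB u)) (exB u)
starBC-realizes {n} {zero  , b} _         = star-realizes (labelsBC n) -<+
starBC-realizes {n} {suc a , b} (a<b , _) = •-realizes (labels-unique (ℤ.- + n) (+ n))
  (λ { (here ≡.refl) (here ()) })
  (star-realizes (labelsBC n) (+<+ (s≤s a<b))) (star-realizes (labelsBC n) (-<- a<b))

kindB : ∀ n → Kind n
kindB n = record
  { L       = labelsBC n
  ; unique  = labels-unique (ℤ.- + n) (+ n)
  ; cell    = starBC n
  ; enc     = encB
  ; ex      = exB
  ; realization = realizationB n
  ; enc∈ex      = λ { (zero , _) → here ≡.refl ; (suc _ , _) → here ≡.refl }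
  ; enc-Nested  = λ {u} {v} → nested {u} {v}
  ; enc-Meet    = λ {u} {v} → meet {u} {v}
  ; enc-<       = λ {u} {v} → less {u} {v}
  ; cell-realizes = starBC-realizes
  ; ex-within   = λ {u} v p → within v (inB {u} p)
  ; through⇒throughᵁ = from-through
  ; throughᵁ⇒through = to-through
  }
  where
  nested : ∀ {u v} → Nestedᵁ u v → Nested (encB u) (encB v)
  nested {zero  , b} {zero  , d} (_ , q) = -≤- q , +≤+ (s≤s q)
  nested {suc a , b} {zero  , d} (_ , q) = -≤+ , +≤+ (s≤s q)
  nested {suc a , b} {suc c , d} (p , q) = +≤+ p , +≤+ (s≤s q)
  meet : ∀ {u v} → Meetᵁ u v → Meet (encB u) (encB v)
  meet {zero  , b} {zero  , d} _       = -≤+ , -≤+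
  meet {suc a , b} {zero  , d} (p , _) = +≤+ p , -≤+
  meet {zero  , b} {suc c , d} (_ , q) = -≤+ , +≤+ q
  meet {suc a , b} {suc c , d} (p , q) = +≤+ p , +≤+ q
  less : ∀ {u v} → u <ᵁ v → lo (encB u) < lo (encB v)
  less {zero  , b} {suc c , d} _ = -<+
  less {suc a , b} {suc c , d} l = +<+ l
  within : ∀ {u I} → Valid n u → InB u I → lo I ≤ hi I × lo I ∈ labelsBC n × hi I ∈ labelsBC n
  within (_   , b<n) mid = -≤+ , labelsBC-∈⁺ n (neg b<n) , labelsBC-∈⁺ n (pos b<n)
  within (a<b , b<n) pos = +≤+ (ℕ.m≤n⇒m≤1+n a<b) , labelsBC-∈⁺ n (pos (ℕ.<-trans a<b b<n)) , labelsBC-∈⁺ n (pos b<n)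
  within (a<b , b<n) neg = -≤- (ℕ.<⇒≤ a<b) , labelsBC-∈⁺ n (neg b<n) , labelsBC-∈⁺ n (neg (ℕ.<-trans a<b b<n))
  from-through : ∀ {us vs} → All (Valid n) us → All (Valid n) vs →
    (∀ i → through i (concatMap exB us) ≡ through i (concatMap exB vs)) → ∀ k → throughᵁ k us ≡ throughᵁ k vs
  from-through {us} {vs} _ _ eq = λ
    { zero    → ≡.trans (through-0 us) (≡.trans (cong (throughᵁ 0) (positive 0)) (≡.sym (through-0 vs)))
    ; (suc k) → positive k }
    where
    positive : ∀ k → throughᵁ (suc k) us ≡ throughᵁ (suc k) vs
    positive k = map-injective encB-injective
      (≡.trans (≡.sym (through-pos n k us)) (≡.trans (eq (+ suc k)) (through-pos n k vs)))
  to-through : ∀ {us vs} → All (Valid n) us → All (Valid n) vs →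
    (∀ {k} → k ℕ.≤ n → throughᵁ k us ≡ throughᵁ k vs) →
    ∀ {i} → i ∈ labelsBC n → through i (concatMap exB us) ≡ through i (concatMap exB vs)
  to-through {us} {vs} _ _ eq i∈ with labelsBC-∈⁻ n i∈
  ... | pos {k} k<n = ≡.trans (through-pos n k us)
    (≡.trans (cong (map encB) (eq k<n)) (≡.sym (through-pos n k vs)))
  ... | neg {k} k<n = ≡.trans (through-neg n k us)
    (≡.trans (cong (map mirrorB) (eq k<n)) (≡.sym (through-neg n k vs)))

networkB≡ : ∀ n xs → Kind.network (kindB n) xs ≡ networkBC n xs
networkB≡ n []       = ≡.refl
networkB≡ n (I ∷ xs) = cong (starBC n I •_) (networkB≡ n xs)

decodeB : ∀ n {xs} → All (BCInterval n) xs → ∃ (Kind.Decodes (kindB n) xs)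
decodeB n [] = [] , Kind.[]
decodeB n (inj₁ (+≤+ {n = suc a} _ , +≤+ {n = suc b} (s≤s a≤b) , +≤+ b<n) ∷ all) with decodeB n all | a ℕ.<? b
... | us , dec | yes a<b = (suc a , b) ∷ us , Kind.keep (a<b , b<n) dec
... | us , dec | no  a≮b = us , Kind.skip (•-realizes (labels-unique (ℤ.- + n) (+ n)) (λ ())
        (star-realizes-[] (labelsBC n) {+ suc a} {+ suc b} (λ { (+<+ (s≤s q)) → a≮b q }))
        (star-realizes-[] (labelsBC n) { -[1+ b ]} { -[1+ a ]} (λ { (-<- q) → a≮b q }))) dec
-- A symmetric interval is never trivial: the smallest one, [-1 , 1], is `(0 , 0)`.
decodeB n (inj₂ (+≤+ {n = suc b} _ , +≤+ b<n , ≡.refl) ∷ all) with decodeB n all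
... | us , dec = (zero , b) ∷ us , Kind.keep (z≤n , b<n) dec

BCInterval-encB : ∀ {n us} → All (Valid n) us → All (BCInterval n) (map encB us)
BCInterval-encB [] = []
BCInterval-encB {us = (zero  , b) ∷ us} ((_ , b<n) ∷ all) = inj₂ (+≤+ (s≤s z≤n) , +≤+ b<n , ≡.refl) ∷ BCInterval-encB all
BCInterval-encB {us = (suc a , b) ∷ us} ((a<b , b<n) ∷ all) =
  inj₁ (+≤+ (s≤s z≤n) , +≤+ (ℕ.m≤n⇒m≤1+n a<b) , +≤+ b<n) ∷ BCInterval-encB all

-- Chains of abstract intervals

_⊏_ : U → U → Set
u ⊏ v = u <ᵁ v × proj₂ u ℕ.< proj₂ v

Chain : List U → Set
Chain = AllPairs (λ u v → v ⊏ u)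

Chain-Before : ∀ {us u v} → Chain us → Before u v us → v ⊏ u
Chain-Before (p ∷ _) (here v∈) = All.lookup p v∈
Chain-Before (_ ∷ c) (there b) = Chain-Before c b

Chain⇒NonNesting : ∀ {us} → Chain us → NonNestingᵁ us
Chain⇒NonNesting c b with Chain-Before c b
... | p , q = (λ (_ , r) → ℕ.<⇒≱ q r) , (λ (r , _) → ℕ.<⇒≱ p r)

Chain⇒Descending : ∀ {us} → Chain us → Descendingᵁ us
Chain⇒Descending c b _ = proj₁ (Chain-Before c b)

Comparable : U → U → Set
Comparable u v = u ⊏ v ⊎ v ⊏ u

insert : U → List U → List U
insert u [] = u ∷ []
insert u (v ∷ vs) with proj₁ v ℕ.<? proj₁ u
... | yes _ = u ∷ v ∷ vs
... | no  _ = v ∷ insert u vs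

sort : List U → List U
sort []       = []
sort (u ∷ us) = insert u (sort us)

insert-↭ : ∀ u vs → insert u vs ↭ u ∷ vs
insert-↭ u [] = refl
insert-↭ u (v ∷ vs) with proj₁ v ℕ.<? proj₁ u
... | yes _ = refl
... | no  _ = trans (prep v (insert-↭ u vs)) (swap v u refl)

sort-↭ : ∀ us → sort us ↭ us
sort-↭ []       = refl
sort-↭ (u ∷ us) = trans (insert-↭ u (sort us)) (prep u (sort-↭ us))

⊏-trans : ∀ {u v w} → u ⊏ v → v ⊏ w → u ⊏ w
⊏-trans (p , q) (r , s) = ℕ.<-trans p r , ℕ.<-trans q s

insert-Chain : ∀ {u vs} → All (Comparable u) vs → Chain vs → Chain (insert u vs)
insert-Chain {vs = []} _ _ = [] ∷ []
insert-Chain {u} {v ∷ vs} (cmp ∷ cmps) (p ∷ c) with proj₁ v ℕ.<? proj₁ u | cmp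
... | yes _   | inj₂ v⊏u = (v⊏u ∷ All.map (λ w⊏v → ⊏-trans w⊏v v⊏u) p) ∷ p ∷ c
... | yes v<u | inj₁ u⊏v = ⊥-elim (ℕ.<-asym v<u (proj₁ u⊏v))
... | no  _   | inj₁ u⊏v = All-resp-↭ (↭-sym (insert-↭ u vs)) (u⊏v ∷ p) ∷ insert-Chain cmps c
... | no v≮u  | inj₂ v⊏u = contradiction (proj₁ v⊏u) v≮u

NonNesting⇒Comparable : ∀ {u v} → ¬ Nestedᵁ u v → ¬ Nestedᵁ v u → Comparable u v
NonNesting⇒Comparable {a , b} {c , d} ¬uv ¬vu with ℕ.<-cmp a c
... | tri< l _ _ = inj₁ (l , <⇒<₂ ¬vu l)
... | tri> _ _ l = inj₂ (l , <⇒<₂ ¬uv l)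
... | tri≈ _ ≡.refl _ = ⊥-elim ([ (λ p → ¬uv (ℕ.≤-refl , p)) , (λ p → ¬vu (ℕ.≤-refl , p)) ]′ (ℕ.≤-total b d))

-- Non-nesting makes any two entries comparable in both coordinates at once, so sorting by left
-- endpoints sorts the right endpoints too.
sort-Chain : ∀ {us} → NonNestingᵁ us → Chain (sort us)
sort-Chain {[]}     _  = []
sort-Chain {u ∷ us} nn = insert-Chain
  (All-resp-↭ (↭-sym (sort-↭ us)) (All.tabulate (λ v∈ → let p , q = nn (here v∈) in NonNesting⇒Comparable p q)))
  (sort-Chain (nn ∘ there))

-- chains c d lists the chains of intervals (a , b) with a < c and b < d, and
-- heads c d those whose first interval is (a , d) with a < c.

chains heads : ℕ → ℕ → List (List U)
chains c zero    = [] ∷ []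
-- The left summand has no entry with `b = d`. There `a ≤ b < d`, so the bound on `a` may be cut
-- down to `d`, which preserves the condition `c ≤ d` of the count.
chains c (suc d) = chains (c ℕ.⊓ d) d ++ heads c d
heads zero    d = []
heads (suc a) d = heads a d ++ map ((a , d) ∷_) (chains a d)

Below : ℕ → ℕ → U → Set
Below c d (a , b) = a ℕ.≤ b × a ℕ.< c × b ℕ.< d

mutual
  -- The bound `c ≤ d` guarantees that a first interval `(a , d)` produced by `heads` satisfies
  -- `a ≤ d`.
  chains-sound : ∀ {c us} d → c ℕ.≤ d → us ∈ chains c d → Chain us × All (Below c d) us
  chains-sound zero    _   (here ≡.refl) = [] , []
  chains-sound {c} (suc d) c≤d p with ∈-++⁻ (chains (c ℕ.⊓ d) d) p
  ... | inj₂ q = heads-sound c d c≤d q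
  ... | inj₁ q with chains-sound d (ℕ.m⊓n≤n c d) q
  ...   | chain , below = chain ,
            All.map (λ (r , s , t) → r , ℕ.<-≤-trans s (ℕ.m⊓n≤m c d) , ℕ.m<n⇒m<1+n t) below

  heads-sound : ∀ {us} c d → c ℕ.≤ suc d → us ∈ heads c d → Chain us × All (Below c (suc d)) us
  heads-sound (suc a) d (s≤s a≤d) p with ∈-++⁻ (heads a d) p
  ... | inj₁ q with heads-sound a d (ℕ.m≤n⇒m≤1+n a≤d) q
  ...   | chain , below = chain , All.map (λ (r , s , t) → r , ℕ.m<n⇒m<1+n s , t) below
  heads-sound (suc a) d (s≤s a≤d) p | inj₂ q with ∈-map⁻ ((a , d) ∷_) q
  ... | vs , vs∈ , ≡.refl with chains-sound d a≤d vs∈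
  ...   | chain , below = All.map proj₂ below ∷ chain
        , (a≤d , ℕ.≤-refl , ℕ.≤-refl) ∷ All.map (λ (r , s , t) → r , ℕ.m<n⇒m<1+n s , ℕ.m<n⇒m<1+n t) below

heads-∷ : ∀ {us} c d → us ∈ heads c d → ∃₂ λ a vs → us ≡ (a , d) ∷ vs × a ℕ.< c
heads-∷ (suc a) d p with ∈-++⁻ (heads a d) p
... | inj₁ q with heads-∷ a d q
...   | a′ , vs , eq , l = a′ , vs , eq , ℕ.m<n⇒m<1+n l
heads-∷ (suc a) d p | inj₂ q with ∈-map⁻ ((a , d) ∷_) q
... | vs , _ , eq = a , vs , eq , ℕ.≤-refl

∈-heads : ∀ {a c d vs} → a ℕ.< c → vs ∈ chains a d → (a , d) ∷ vs ∈ heads c d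
∈-heads {a} {suc c} {d} a<c p with a ℕ.≟ c
... | yes ≡.refl = ∈-++⁺ʳ (heads c d) (∈-map⁺ ((c , d) ∷_) p)
... | no  a≢c    = ∈-++⁺ˡ (∈-heads (ℕ.≤∧≢⇒< (ℕ.≤-pred a<c) a≢c) p)

chains-complete : ∀ {c us} d → Chain us → All (Below c d) us → us ∈ chains c d
chains-complete {us = []}     zero    _ _                = here ≡.refl
chains-complete {us = _ ∷ _}  zero    _ ((_ , _ , ()) ∷ _)
chains-complete {us = []}     (suc d) _ _                = ∈-++⁺ˡ (chains-complete d [] [])
chains-complete {c} {(a , b) ∷ us} (suc d) (p ∷ chain) ((a≤b , a<c , b<1+d) ∷ below) with b ℕ.≟ d
... | yes ≡.refl = ∈-++⁺ʳ (chains (c ℕ.⊓ d) d) (∈-heads a<c (chains-complete d chain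
        (All.zipWith (λ ((a′<a , b′<b) , (r , _ , _)) → r , a′<a , b′<b) (p , below))))
... | no  b≢d    = ∈-++⁺ˡ (chains-complete d (p ∷ chain)
        ((a≤b , ℕ.⊓-glb a<c (ℕ.≤-<-trans a≤b b<d) , b<d)
        ∷ All.zipWith (λ ((_ , b′<b) , (r , s , _)) →
            r , ℕ.⊓-glb s (ℕ.≤-<-trans r (ℕ.<-trans b′<b b<d)) , ℕ.<-trans b′<b b<d) (p , below)))
  where b<d = ℕ.≤∧≢⇒< (ℕ.≤-pred b<1+d) b≢d

mutual
  chains-unique : ∀ c d → c ℕ.≤ d → Unique (chains c d)
  chains-unique c zero    _   = [] ∷ []
  chains-unique c (suc d) c≤d = Unique.++⁺ (chains-unique (c ℕ.⊓ d) d (ℕ.m⊓n≤n c d)) (heads-unique c d c≤d) disjoint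
    where
    disjoint : ∀ {us} → us ∈ chains (c ℕ.⊓ d) d × us ∈ heads c d → ⊥
    disjoint (p , q) with heads-∷ c d q
    ... | _ , _ , ≡.refl , _ with chains-sound d (ℕ.m⊓n≤n c d) p
    ...   | _ , (_ , _ , d<d) ∷ _ = ℕ.<-irrefl ≡.refl d<d

  heads-unique : ∀ c d → c ℕ.≤ suc d → Unique (heads c d)
  heads-unique zero    d _         = []
  heads-unique (suc a) d (s≤s a≤d) = Unique.++⁺ (heads-unique a d (ℕ.m≤n⇒m≤1+n a≤d))
    (Unique.map⁺ ∷-injectiveʳ (chains-unique a d a≤d)) disjoint
    where
    disjoint : ∀ {us} → us ∈ heads a d × us ∈ map ((a , d) ∷_) (chains a d) → ⊥
    disjoint (p , q) with heads-∷ a d p | ∈-map⁻ ((a , d) ∷_) q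
    ... | _ , _ , ≡.refl , l | _ , _ , eq = ℕ.<⇒≢ l (cong proj₁ (∷-injectiveˡ eq))

-- Counting chains by ballot numbers

infixl 6.5 _C⁻_

-- The binomial coefficient n C (k - 1), zero for k = 0.
_C⁻_ : ℕ → ℕ → ℕ
n C⁻ zero  = 0
n C⁻ suc k = n C k

nC0≡1 : ∀ n → n C 0 ≡ 1
nC0≡1 n = ≡.trans (nCk≡nC[n∸k] {k = 0} {n} z≤n) (nCn≡1 n)

pascal : ∀ n k → suc n C k ≡ n C k + n C⁻ k
pascal n zero    = ≡.trans (nC0≡1 (suc n)) (sym (≡.trans (ℕ.+-identityʳ _) (nC0≡1 n)))
pascal n (suc k) = ≡.trans (sym (nCk+nC[k+1]≡[n+1]C[k+1] n k)) (ℕ.+-comm (n C k) _)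

-- Ballot numbers are differences of neighbouring binomial coefficients, written additively to avoid
-- truncated subtraction. They inherit Pascal's recursion from both terms.
ballot-step : ∀ n k {h x} → h + n C⁻ k ≡ n C k → x + n C k ≡ n C suc k →
  (x + h) + suc n C k ≡ suc n C suc k
ballot-step n k {h} {x} p q = begin
  (x + h) + suc n C k            ≡⟨ cong ((x + h) ℕ.+_) (pascal n k) ⟩
  (x + h) + (n C k + n C⁻ k)     ≡⟨ +-*-Solver.solve 4 (λ x h a b → (x :+ h) :+ (a :+ b) := (x :+ a) :+ (h :+ b)) ≡.refl x h (n C k) (n C⁻ k) ⟩
  (x + n C k) + (h + n C⁻ k)     ≡⟨ cong₂ _+_ q p ⟩
  n C suc k + n C k              ≡⟨ pascal n (suc k) ⟨
  suc n C suc k                  ∎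
  where
  open ≡.≡-Reasoning
  open +-*-Solver

mutual
  -- This is the ballot number for `d + 1` votes against `c` with the leader never behind.
  length-chains : ∀ c d → c ℕ.≤ d → length (chains c d) + (suc d + c) C⁻ c ≡ (suc d + c) C c
  length-chains zero    zero    _ = ≡.refl
  length-chains zero    (suc d) _ = ≡.trans
    (cong (λ k → k + 0) (≡.trans (cong length (++-identityʳ (chains 0 d))) (≡.trans (sym (ℕ.+-identityʳ _)) (length-chains 0 d z≤n))))
    (≡.trans (ℕ.+-identityʳ _) (≡.trans (nC0≡1 (suc d + 0)) (sym (nC0≡1 (suc (suc d) + 0)))))
  length-chains (suc c) (suc d) (s≤s c≤d) = ≡.trans
    (cong (_+ (suc (suc d) + suc c) C c) (length-++ (chains (suc c ℕ.⊓ d) d)))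
    (ballot-step (suc d + suc c) c {length (heads (suc c) d)} (length-heads c d c≤d) (length-chains-⊓ c d c≤d))

  -- For c = d the chains have b < d, so a < d comes for free, and the two
  -- middle binomial coefficients agree.
  length-chains-⊓ : ∀ c d → c ℕ.≤ d →
    length (chains (suc c ℕ.⊓ d) d) + (suc d + suc c) C c ≡ (suc d + suc c) C suc c
  length-chains-⊓ c d c≤d with c ℕ.≟ d
  ... | no c≢d rewrite ℕ.m≤n⇒m⊓n≡m (ℕ.≤∧≢⇒< c≤d c≢d) = length-chains (suc c) d (ℕ.≤∧≢⇒< c≤d c≢d)
  ... | yes ≡.refl rewrite ℕ.m≥n⇒m⊓n≡n (ℕ.n≤1+n c) | ℕ.+-suc c c = begin
    x + suc m C c              ≡⟨ cong (x ℕ.+_) (pascal m c) ⟩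
    x + (m C c + m C⁻ c)       ≡⟨ +-*-Solver.solve 3 (λ x a b → x :+ (a :+ b) := (x :+ b) :+ a) ≡.refl x (m C c) (m C⁻ c) ⟩
    (x + m C⁻ c) + m C c       ≡⟨ cong (_+ m C c) (length-chains c c ℕ.≤-refl) ⟩
    m C c + m C c              ≡⟨ cong (_+ m C c) (≡.trans (nCk≡nC[n∸k] {k = c} {m} (ℕ.m≤n+m c (suc c))) (cong (m C_) (ℕ.m+n∸n≡m (suc c) c))) ⟩
    m C suc c + m C c          ≡⟨ pascal m (suc c) ⟨
    suc m C suc c              ∎
    where
    open ≡.≡-Reasoning
    open +-*-Solver
    x = length (chains c c)
    m = suc (c + c)

  -- The value is the one for `chains c (suc d)`: raising the bound on the first left endpoint adds
  -- one term `chains a d`, and `ballot-step` absorbs it.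
  length-heads : ∀ c d → c ℕ.≤ d → length (heads (suc c) d) + (suc d + suc c) C⁻ c ≡ (suc d + suc c) C c
  length-heads zero    d _ = ≡.trans
    (cong (_+ 0) (≡.trans (length-map ((0 , d) ∷_) (chains 0 d))
      (≡.trans (sym (ℕ.+-identityʳ _)) (length-chains 0 d z≤n))))
    (≡.trans (ℕ.+-identityʳ _) (≡.trans (nC0≡1 (suc d + 0)) (sym (nC0≡1 (suc d + 1)))))
  length-heads (suc c) d c<d = ≡.subst (λ k → length (heads (suc (suc c)) d) + k C c ≡ k C suc c) (sym (ℕ.+-suc (suc d) (suc c)))
    (≡.trans (cong (_+ suc (suc d + suc c) C c)
      (≡.trans (length-++ (heads (suc c) d)) (≡.trans (ℕ.+-comm (length (heads (suc c) d)) _)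
        (cong (_+ length (heads (suc c) d)) (length-map ((suc c , d) ∷_) (chains (suc c) d))))))
      (ballot-step (suc d + suc c) c {length (heads (suc c) d)} (length-heads c d (ℕ.<⇒≤ c<d)) (length-chains (suc c) d c<d)))

absorption : ∀ n k → suc k * (suc n C suc k) ≡ suc n * (n C k)
absorption zero zero    = ≡.refl
absorption zero (suc k) = ≡.trans (cong (suc (suc k) *_) (k>n⇒nCk≡0 {1} {suc (suc k)} (s≤s (s≤s z≤n))))
  (≡.trans (ℕ.*-zeroʳ (suc (suc k))) (sym (≡.trans (ℕ.*-identityˡ _) (k>n⇒nCk≡0 {0} {suc k} (s≤s z≤n)))))
absorption (suc n) zero = ≡.trans (ℕ.*-identityˡ _) (≡.trans (nC1≡n (suc (suc n)))
  (sym (≡.trans (cong (suc (suc n) *_) (nC0≡1 (suc n))) (ℕ.*-identityʳ _))))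
absorption (suc n) (suc k) = begin
  suc (suc k) * (suc (suc n) C suc (suc k))
    ≡⟨ cong (suc (suc k) *_) (pascal (suc n) (suc (suc k))) ⟩
  suc (suc k) * (b + a)
    ≡⟨ +-*-Solver.solve 3 (λ k a b → (con 2 :+ k) :* (b :+ a) := ((con 2 :+ k) :* b :+ (con 1 :+ k) :* a) :+ a) ≡.refl k a b ⟩
  (suc (suc k) * b + suc k * a) + a
    ≡⟨ cong (_+ a) (cong₂ _+_ (absorption n (suc k)) (absorption n k)) ⟩
  (suc n * (n C suc k) + suc n * (n C k)) + a
    ≡⟨ cong (_+ a) (ℕ.*-distribˡ-+ (suc n) (n C suc k) (n C k)) ⟨
  suc n * (n C suc k + n C k) + a
    ≡⟨ cong (λ x → suc n * x + a) (pascal n (suc k)) ⟨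
  suc n * a + a
    ≡⟨ ℕ.+-comm (suc n * a) a ⟩
  suc (suc n) * a ∎
  where
  open ≡.≡-Reasoning
  open +-*-Solver
  a = suc n C suc k
  b = suc n C suc (suc k)

-- With `b` the central coefficient over `2n + 2` and `a` its left neighbour, the count is `b - a`.
-- Since `(n + 1) b = (n + 2) a`, multiplying by `n + 2` leaves `b`.
length-chains-catalan : ∀ n → length (chains n n) ≡ catalan (suc n)
length-chains-catalan n = sym (begin
  ((2 * suc n) C suc n) / suc (suc n)  ≡⟨ cong (λ m → (m C suc n) / suc (suc n)) (cong (suc n ℕ.+_) (ℕ.+-identityʳ (suc n))) ⟩
  b / suc (suc n)                    ≡⟨ cong (_/ suc (suc n)) total ⟨
  x * suc (suc n) / suc (suc n)      ≡⟨ m*n/n≡m x (suc (suc n)) ⟩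
  x                                  ∎)
  where
  open ≡.≡-Reasoning
  open +-*-Solver
  N = suc n + suc n
  x = length (chains n n)
  a = N C n
  b = N C suc n
  -- The diagonal case of `length-chains-⊓` counts the same chains as `length-chains`, but over
  -- `2n + 2` instead of `2n + 1`.
  x+a≡b : x + a ≡ b
  x+a≡b = subst (λ k → length (chains k n) + a ≡ b) (ℕ.m≥n⇒m⊓n≡n (ℕ.n≤1+n n)) (length-chains-⊓ n n ℕ.≤-refl)
  ratio : suc n * b ≡ suc (suc n) * a
  ratio = ℕ.+-cancelʳ-≡ (suc n * a) _ _ (begin
    suc n * b + suc n * a        ≡⟨ ℕ.*-distribˡ-+ (suc n) b a ⟨
    suc n * (b + a)              ≡⟨ cong (suc n *_) (pascal N (suc n)) ⟨
    suc n * (suc N C suc n)        ≡⟨ absorption N n ⟩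
    suc N * a                    ≡⟨ solve 2 (λ n a → (con 1 :+ ((con 1 :+ n) :+ (con 1 :+ n))) :* a := (con 2 :+ n) :* a :+ (con 1 :+ n) :* a) ≡.refl n a ⟩
    suc (suc n) * a + suc n * a  ∎)
  total : x * suc (suc n) ≡ b
  total = ℕ.+-cancelʳ-≡ (suc n * b) _ _ (begin
    x * suc (suc n) + suc n * b        ≡⟨ cong (x * suc (suc n) ℕ.+_) ratio ⟩
    x * suc (suc n) + suc (suc n) * a  ≡⟨ solve 3 (λ n x a → x :* (con 2 :+ n) :+ (con 2 :+ n) :* a := (con 2 :+ n) :* (x :+ a)) ≡.refl n x a ⟩
    suc (suc n) * (x + a)              ≡⟨ cong (suc (suc n) *_) x+a≡b ⟩
    b + suc n * b                      ∎)

-- Sizes from lists of representatives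

HasSize-cong : ∀ {P N N′ k} → (∀ xs → N xs ≡ N′ xs) → HasSize P N k → HasSize P N′ k
HasSize-cong eq (rep , sound , distinct , cover) = rep , sound
  , (λ r s iso → distinct r s (≡.subst₂ _≅_ (sym (eq (rep r))) (sym (eq (rep s))) iso))
  , (λ xs p → let r , iso = cover xs p in r , ≡.subst₂ _≅_ (eq xs) (eq (rep r)) iso)

module _ {n} (K : Kind n) where
  open Kind K

  -- Since profiles are a complete invariant, representatives need only be distinct and exhaustive
  -- up to `profile`; `Q` is the abstract counterpart of `P`.
  hasSize : ∀ {P : List Interval → Set} {Q : List U → Set} (reps : List (List U)) →
    (∀ {us} → Q us → All (Valid n) us × Zigᵁ us × P (map enc us)) →
    (∀ {us} → us ∈ reps → Q us) →
    (∀ r s → profile n (lookup reps r) ≡ profile n (lookup reps s) → r ≡ s) →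
    (∀ {us} → Q us → ∃ λ vs → vs ∈ reps × profile n us ≡ profile n vs) →
    (∀ {xs} → P xs → ∃ λ us → Decodes xs us × Q us) →
    HasSize P network (length reps)
  hasSize {P} reps Q⇒ sound distinct cover decode =
    (λ r → map enc (lookup reps r)) , (λ r → proj₂ (proj₂ (info r))) , separate , covered
    where
    info : ∀ r → _
    info r = Q⇒ (sound (∈-lookup {xs = reps} r))
    separate : ∀ r s → network (map enc (lookup reps r)) ≅ network (map enc (lookup reps s)) → r ≡ s
    separate r s iso = let v , z , _ = info r ; v′ , z′ , _ = info s in
      distinct r s (≅⇒profile (map-Decodes v) (map-Decodes v′) z z′ iso)
    covered : ∀ xs → P xs → ∃ λ r → network xs ≅ network (map enc (lookup reps r))
    covered xs p with decode p
    ... | us , d , q with cover q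
    ...   | vs , vs∈ , eq with Q⇒ q | Q⇒ (sound vs∈)
    ...     | _ , z , _ | v′ , z′ , _ = Any.index vs∈ ,
      subst (λ ws → network xs ≅ network (map enc ws)) (Any.lookup-index vs∈)
        (profile⇒≅ d (map-Decodes v′) (Zigᵁ.nonNesting z) (Zigᵁ.nonNesting z′) eq)

-- Descending sequences

IsDescending : ℕ → List U → Set
IsDescending n us = All (Valid n) us × NonNestingᵁ us × Descendingᵁ us

chains-IsDescending : ∀ {n us} → us ∈ chains n n → IsDescending n us
chains-IsDescending {n} us∈ with chains-sound n ℕ.≤-refl us∈
... | chain , below = All.map (λ (p , _ , q) → p , q) below , Chain⇒NonNesting chain , Chain⇒Descending chain

-- A chain is determined by its set of entries, which the profile shows.
profile-injective : ∀ {n us vs} → us ∈ chains n n → vs ∈ chains n n → profile n us ≡ profile n vs → us ≡ vs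
profile-injective {n} {us} {vs} us∈ vs∈ eq with chains-sound n ℕ.≤-refl us∈ | chains-sound n ℕ.≤-refl vs∈
... | c , _ | c′ , _ = ordered-unique (λ p q → ℕ.<-asym p q)
  (λ b → proj₁ (Chain-Before c b)) (λ b → proj₁ (Chain-Before c′ b))
  ( profile⇒⊆ {us = us} {vs} eq (proj₁ (chains-IsDescending us∈))
  , profile⇒⊆ {us = vs} {us} (sym eq) (proj₁ (chains-IsDescending vs∈)))

chains-distinct : ∀ n r s → profile n (lookup (chains n n) r) ≡ profile n (lookup (chains n n) s) → r ≡ s
chains-distinct n r s eq = lookup-injective-on (λ us → us) (chains-unique n n ℕ.≤-refl) r s
  (profile-injective (∈-lookup r) (∈-lookup s) eq)

-- All intervals through i meet, so a descending sequence is sorted along each wire.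
sort-profile : ∀ n {us} → NonNestingᵁ us → Descendingᵁ us → profile n us ≡ profile n (sort us)
sort-profile n {us} nn desc = map-cong same (upTo (suc n))
  where
  restrict : ∀ i {vs ws} → vs ↭ ws → ∀ {u} → u ∈ throughᵁ i vs → u ∈ throughᵁ i ws
  restrict i p = ∈-resp-↭ (filter-↭ (∋ᵁ? i) p)
  same : ∀ i → throughᵁ i us ≡ throughᵁ i (sort us)
  same i = ordered-unique {R = λ u v → v <ᵁ u} (λ p q → ℕ.<-asym p q) ordered
    (λ b → proj₁ (Chain-Before (sort-Chain nn) (proj₁ (Before-filter⁻ (∋ᵁ? i) (sort us) b))))
    (restrict i (↭-sym (sort-↭ us)) , restrict i (sort-↭ us))
    where
    ordered : ∀ {u v} → Before u v (throughᵁ i us) → v <ᵁ u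
    ordered b with Before-filter⁻ (∋ᵁ? i) us b
    ... | b′ , (p , q) , (r , s) = desc b′ (ℕ.≤-trans p s , ℕ.≤-trans r q)

chains-cover : ∀ {n us} → IsDescending n us → ∃ λ vs → vs ∈ chains n n × profile n us ≡ profile n vs
chains-cover {n} {us} (valid , nn , desc) = sort us
  , chains-complete n (sort-Chain nn)
      (All-resp-↭ (↭-sym (sort-↭ us)) (All.map (λ (p , q) → p , ℕ.≤-<-trans p q , q) valid))
  , sort-profile n nn desc

hasSize-descending : ∀ {n} (K : Kind n) (let open Kind K) {In : Interval → Set} →
  (∀ {us} → All (Valid n) us → All In (map enc us)) → (∀ {xs} → All In xs → ∃ (Decodes xs)) →
  HasSize (λ xs → All In xs × Descending xs) network (catalan (suc n))
hasSize-descending {n} K {In} In-enc decode = subst (HasSize _ network) (length-chains-catalan n)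
  (hasSize K {λ xs → All In xs × Descending xs} {IsDescending n} (chains n n)
    (λ (valid , nn , desc) → valid , Descendingᵁ⇒Zigᵁ nn desc , In-enc valid , map-Descending valid nn desc)
    chains-IsDescending (chains-distinct n) chains-cover
    (λ (all , desc) → let us , d = decode all in
      us , d , Decodes-Valid d , Decodes-NonNesting d (DistinctNonNesting⇒NonNesting (proj₁ desc)) , Decodes-Descending d desc))
  where open Kind K

-- Zig-zag sequences

-- The abstract condition is tested on the type A encoding, where it quantifies over finitely many
-- positions and is decidable.
IsZigZag : ℕ → List U → Set
IsZigZag n us = All (Valid n) us × ZigZag (map encA us)

IsZigZag⇒Zig : ∀ {n us} → IsZigZag n us → Zigᵁ us
IsZigZag⇒Zig {n} (valid , zig) = Kind.Decodes-Zig (kindA n) (Kind.map-Decodes (kindA n) valid) (ZigZag⇒Zig zig)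

Zig⇒IsZigZag : ∀ {n us} → All (Valid n) us → Zigᵁ us → IsZigZag n us
Zig⇒IsZigZag {n} valid zig = valid , Kind.map-ZigZag (kindA n) valid zig

Nested? : ∀ I J → Dec (Nested I J)
Nested? I J = (lo J ≤? lo I) ×-dec (hi I ≤? hi J)

Meet? : ∀ I J → Dec (Meet I J)
Meet? I J = (lo I ≤? hi J) ×-dec (lo J ≤? hi I)

ZigZag? : ∀ xs → Dec (ZigZag xs)
ZigZag? xs =
  (allPairs? (λ I J → ¬? (≡-dec-× _≟_ _≟_ I J)) xs ×-dec
   Fin.all? λ i → Fin.all? λ j → ¬? (i Fin.≟ j) →-dec ¬? (Nested? (lookup xs i) (lookup xs j))) ×-dec
  Fin.all? λ i → Fin.all? λ j → Fin.all? λ k → (i Fin.<? j) →-dec ((j Fin.<? k) →-dec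
    (Meet? (lookup xs i) (lookup xs j) →-dec (Meet? (lookup xs j) (lookup xs k) →-dec
      (((lo (lookup xs i) <? lo (lookup xs j)) ×-dec (lo (lookup xs j) <? lo (lookup xs k))) ⊎-dec
       ((lo (lookup xs j) <? lo (lookup xs i)) ×-dec (lo (lookup xs k) <? lo (lookup xs j)))))))

IsZigZag? : ∀ n → Decidable (IsZigZag n)
IsZigZag? n us = All.all? (λ (a , b) → (a ℕ.≤? b) ×-dec (b ℕ.<? n)) us ×-dec ZigZag? (map encA us)

module _ {A : Set} where

  listsUpTo : List A → ℕ → List (List A)
  listsUpTo xs zero    = [] ∷ []
  listsUpTo xs (suc k) = [] ∷ concatMap (λ x → map (x ∷_) (listsUpTo xs k)) xs

  ∈-listsUpTo : ∀ {xs us : List A} {k} → All (_∈ xs) us → length us ℕ.≤ k → us ∈ listsUpTo xs k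
  ∈-listsUpTo {k = zero}  []         _       = here ≡.refl
  ∈-listsUpTo {k = suc k} []         _       = here ≡.refl
  ∈-listsUpTo {k = suc k} (p ∷ all) (s≤s l) = there
    (∈-concatMap⁺ _ (Any.map (λ { ≡.refl → ∈-map⁺ _ (∈-listsUpTo all l) }) p))

  Unique⇒length≤ : ∀ {xs us : List A} → Unique us → All (_∈ xs) us → length us ℕ.≤ length xs
  Unique⇒length≤ {xs} {us} unique all = Fin.injective⇒≤ {f = position} injective
    where
    member : ∀ i → lookup us i ∈ xs
    member i = All.lookup all (∈-lookup i)
    position : Fin (length us) → Fin (length xs)
    position i = Any.index (member i)
    injective : ∀ {i j} → position i ≡ position j → i ≡ j
    injective {i} {j} eq = lookup-injective-on (λ x → x) unique i j
      (≡.trans (Any.lookup-index (member i)) (≡.trans (cong (lookup xs) eq) (sym (Any.lookup-index (member j)))))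

module _ (n : ℕ) where

  profileDecSetoid : DecSetoid _ _
  profileDecSetoid = On.decSetoid (≡.decSetoid (≡-dec (≡-dec (≡-dec-× ℕ._≟_ ℕ._≟_)))) (profile n)

  open DecSetoid profileDecSetoid using () renaming (_≟_ to _≟ᴾ_)

  square : List U
  square = cartesianProduct (upTo n) (upTo n)

  -- Valid pairs lie in `square` and entries are distinct, so by the pigeonhole principle no
  -- sequence is longer than `square`. The list depends on `n` alone, hence serves both types.
  candidates zigzags : List (List U)
  candidates = filter (IsZigZag? n) (listsUpTo square (length square))
  zigzags    = deduplicate _≟ᴾ_ candidates

  zigzags-IsZigZag : ∀ {us} → us ∈ zigzags → IsZigZag n us
  zigzags-IsZigZag p = proj₂ (∈-filter⁻ (IsZigZag? n) {xs = listsUpTo square (length square)}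
    (∈-deduplicate⁻ _≟ᴾ_ candidates p))

  zigzags-distinct : ∀ r s → profile n (lookup zigzags r) ≡ profile n (lookup zigzags s) → r ≡ s
  zigzags-distinct = lookup-injective-on (profile n) (deduplicate-! profileDecSetoid candidates)

  zigzags-cover : ∀ {us} → IsZigZag n us → ∃ λ vs → vs ∈ zigzags × profile n us ≡ profile n vs
  zigzags-cover {us} q@(valid , zig) = find (Any.deduplicate⁺ _≟ᴾ_ (λ p eq → ≡.trans eq (sym p))
    (Any.map (λ { ≡.refl → ≡.refl }) us∈))
    where
    inside : All (_∈ square) us
    inside = All.map (λ (p , l) → ∈-cartesianProduct⁺ (∈-upTo⁺ (ℕ.≤-<-trans p l)) (∈-upTo⁺ l)) valid
    unique : Unique us
    unique = Unique⇐Before (λ b → proj₁ (Zigᵁ.nonNesting (IsZigZag⇒Zig q) b) (ℕ.≤-refl , ℕ.≤-refl))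
    us∈ : us ∈ candidates
    us∈ = ∈-filter⁺ (IsZigZag? n) (∈-listsUpTo inside (Unique⇒length≤ unique inside)) q

  hasSize-zigzag : (K : Kind n) (let open Kind K) {In : Interval → Set} →
    (∀ {us} → All (Valid n) us → All In (map enc us)) → (∀ {xs} → All In xs → ∃ (Decodes xs)) →
    HasSize (λ xs → All In xs × ZigZag xs) network (length zigzags)
  hasSize-zigzag K {In} In-enc decode = hasSize K {λ xs → All In xs × ZigZag xs} {IsZigZag n} zigzags
    (λ q → proj₁ q , IsZigZag⇒Zig q , In-enc (proj₁ q) , map-ZigZag (proj₁ q) (IsZigZag⇒Zig q))
    zigzags-IsZigZag zigzags-distinct zigzags-cover
    (λ (all , zig) → let us , d = decode all in
      us , d , Zig⇒IsZigZag (Decodes-Valid d) (Decodes-Zig d (ZigZag⇒Zig zig)))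
    where open Kind K

theorem5p16 : (n : ℕ) →
    (Σ ℕ λ k → HasSize (ZBC n) (networkBC n) k × HasSize (ZA n) (netA n) k) ×
    (HasSize (DBC n) (networkBC n) (catalan (suc n)) ×
    HasSize (DA n) (netA n) (catalan (suc n)))
theorem5p16 n =
  ( length (zigzags n)
  , HasSize-cong (networkB≡ n) (hasSize-zigzag n (kindB n) BCInterval-encB (decodeB n))
  , HasSize-cong (networkA≡ n) (hasSize-zigzag n (kindA n) (InA-encA n) (decodeA n)))
  , HasSize-cong (networkB≡ n) (hasSize-descending (kindB n) BCInterval-encB (decodeB n))
  , HasSize-cong (networkA≡ n) (hasSize-descending (kindA n) (InA-encA n) (decodeA n))
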